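{- Let $x$ be an indeterminate. For all positive integers $n$, $$\det_{0\le i,j\le n-1}\left(4^i\binom {x+i+2j+3}{2j+3}+\binom {x-i+2j+3}{2j+3}\right)=\left(2\cdot 6^{\binom n2}\prod _{i=0} ^{n-1}\frac {i!} {(2i+3)!}\right)\left((x+2)(x+3)\prod _{i=0} ^{n-1}(x+3i+1)_{n-i}\right)\cdot\mathrm{Pol}_n(x),$$ where $\mathrm{Pol}_n(x)$ is a monic polynomial in $x$ of degree $2n-2$.
   Context: The binomial coefficient is $\binom{\alpha}{p}=\frac{\alpha(\alpha-1)\cdots(\alpha-p+1)}{p!}$ if $p\ge 0$ is an integer, and $0$ if $p<0$. The Pochhammer symbol is $(\alpha)_p=\alpha(\alpha+1)\cdots(\alpha+p-1)$ for $p\ge1$ and $(\alpha)_0=1$. The assertion is that for each $n$ such a polynomial $\mathrm{Pol}_n(x)$ (with rational coefficients) exists. -}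

module Defs where

open import Algebra.Bundles.Raw using (RawRing)
import Algebra.Definitions.RawSemiring as RawSemiringDefinitions
open import Data.Fin.Base using (Fin; zero; suc; toℕ; punchIn)
open import Data.Integer.Base using (ℤ; +_; -[1+_])
open import Data.List.Base using (List; []; _∷_; map)
open import Data.Nat.Base as ℕ using (ℕ; zero; suc; _!)
open import Data.Nat.Properties using (_!≢0)
open import Data.Rational.Base as ℚ using (ℚ; 0ℚ; 1ℚ; _/_)
open import Level using (0ℓ)
open import Relation.Binary.PropositionalEquality.Core using (_≡_)

-- Determinant of a square matrix over a ring, by Laplace expansion along the
-- first row; the empty determinant is 1.
module Determinant {c ℓ} (R : RawRing c ℓ) where
  open RawRing R
  open RawSemiringDefinitions rawSemiring using (sum; _^_)

  det : ∀ {n} → (Fin n → Fin n → Carrier) → Carrier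
  det {zero}  A = 1#
  det {suc n} A =
    sum λ j → (- 1#) ^ toℕ j * (A zero j * det λ r s → A (suc r) (punchIn j s))

-- ℚ[x]: coefficient lists, constant term first.  Trailing zeros are allowed,
-- so equality of polynomials is _≈ₚ_ and not _≡_ of lists.
Polynomial : Set
Polynomial = List ℚ

coeff : Polynomial → ℕ → ℚ
coeff []      _       = 0ℚ
coeff (a ∷ p) zero    = a
coeff (a ∷ p) (suc k) = coeff p k

infix 4 _≈ₚ_
_≈ₚ_ : Polynomial → Polynomial → Set
p ≈ₚ q = ∀ k → coeff p k ≡ coeff q k

infixl 6 _+ₚ_
_+ₚ_ : Polynomial → Polynomial → Polynomial
[]      +ₚ q       = q
(a ∷ p) +ₚ []      = a ∷ p
(a ∷ p) +ₚ (b ∷ q) = (a ℚ.+ b) ∷ (p +ₚ q)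

infixl 7 _*ₚ_
_*ₚ_ : Polynomial → Polynomial → Polynomial
[]      *ₚ q = []
(a ∷ p) *ₚ q = map (a ℚ.*_) q +ₚ (0ℚ ∷ (p *ₚ q))

const : ℚ → Polynomial
const a = a ∷ []

ℚ[x] : RawRing 0ℓ 0ℓ
ℚ[x] = record
  { Carrier = Polynomial
  ; _≈_     = _≈ₚ_
  ; _+_     = _+ₚ_
  ; _*_     = _*ₚ_
  ; -_      = map (λ a → ℚ.- a)
  ; 0#      = []
  ; 1#      = const 1ℚ
  }

open RawRing ℚ[x] public using (_≈_; _+_; _*_; -_)
open RawSemiringDefinitions (RawRing.rawSemiring ℚ[x]) public using (product; _^_)
open Determinant ℚ[x] public using (det)

infixl 6 _-_
_-_ : Polynomial → Polynomial → Polynomial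
p - q = p + (- q)

x : Polynomial
x = 0ℚ ∷ 1ℚ ∷ []

nat : ℕ → Polynomial
nat k = const (+ k / 1)

record MonicOfDegree (d : ℕ) (p : Polynomial) : Set where
  field
    leading : coeff p d ≡ 1ℚ
    above   : ∀ k → d ℕ.< k → coeff p k ≡ 0ℚ

∏< : ℕ → (ℕ → Polynomial) → Polynomial
∏< n f = product {n} λ i → f (toℕ i)

syntax ∏< n (λ i → p) = ∏[ i < n ] p

det< : (n : ℕ) → (ℕ → ℕ → Polynomial) → Polynomial
det< n a = det {n} λ i j → a (toℕ i) (toℕ j)

syntax det< n (λ i j → p) = det[ i , j < n ] p

pochhammer : Polynomial → ℕ → Polynomial
pochhammer α p = ∏[ k < p ] (α + nat k)

factorialRatio : ℕ → ℕ → ℚ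
factorialRatio m n = (+ (m !) / (n !)) {{n !≢0}}

-- α(α-1)⋯(α-p+1)/p!, with 1/p! written as 0!/p!.
binomial : Polynomial → ℤ → Polynomial
binomial α (+ p)    = const (factorialRatio 0 p) * (∏[ k < p ] (α - nat k))
binomial α -[1+ _ ] = const 0ℚ

module Submission where

-- With t a formal variable, S = 1 - t, σ = 1/S and g = S^(-x-1), the entry in row
-- i and column j is the coefficient of t^(2j+3) in ((4σ)ⁱ + Sⁱ) g.  As (4σ) S = 4,
-- (4σ)ⁱ + Sⁱ is a monic polynomial of degree i (for i = 0: the constant 2) in
-- u = S + 4σ - 5 = t (3 + t) σ.  So the determinant is 2 det N, where row i of N
-- holds the coefficients of uⁱ g, and these rows may be replaced by those of
-- P(u) g for any monic P of degree i.
--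
-- Divisibility: at x = - k, g = S^(k-1).  Since (u + 3) S = 3 + t² and
-- (u + 1) S³ = (1 - t²)², the series (u + 3)^(s-p) (u + 1)^p g is even for
-- k = s + 2p + 1, and all its odd coefficients vanish.  Each pair p ≤ s thus
-- contributes a factor x + s + 2p + 1 to det N; row 0 contributes x + 2 and x + 3
-- as well, because S and S² have no coefficient beyond t².
--
-- Degree: u = 3 t + O(t²), so the entry (i , j) of N has degree 2j + 3 - i in x
-- with leading coefficient 3ⁱ / (2j + 3 - i)!.  Multiplying row i by xⁱ removes
-- the dependence on i, and the determinant of leading coefficients is a
-- Vandermonde determinant at the nodes 2j + 3.

-- Origin of u + 3 and u + 1: u + c = (t² + (3 - c) t + c) / S. The numerator is even in t for c =
-- 3, and for c = 1 it is (1 + t)², which a further S² completes to an even series. Setting x = - k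
-- means computing modulo x + k: there x is - k, and vanishing is by definition divisibility by x +
-- k. Multiplicity is the obstacle: s + 2p + 1 takes the same value k for several pairs, and 3 is
-- also an extra root of row 0. For a fixed k, however, each row meets k at most once. All rows can
-- then be replaced at once by combinations suited to this k, and x + k leaves the determinant once
-- for every row that meets it. Different k require different replacements, so the powers are joined
-- only afterwards: x + k and x + l are coprime, because their difference is a nonzero rational.
-- Nothing is known of the cofactor except its degree and its leading coefficient. Dividing by the
-- latter gives `Pol`.

open import Algebra.Bundles using (CommutativeRing)
open import Algebra.Bundles.Raw using (RawMonoid; RawRing)
import Algebra.Definitions.RawMonoid as RawMonoidDefinitions
import Algebra.Definitions.RawSemiring as RawSemiringDefinitions
open import Algebra.Morphism.Structures using (IsRingMonomorphism)
import Algebra.Morphism.RingMonomorphism as RingMonomorphism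
import Algebra.Properties.CommutativeSemiring.Exp as Exp
import Algebra.Properties.Ring as RingProperties
import Algebra.Properties.Semiring.Sum as SemiringSum
import Algebra.Solver.Ring
open import Algebra.Solver.Ring.AlmostCommutativeRing
  using (_-Raw-AlmostCommutative⟶_; fromCommutativeRing)
import Algebra.Solver.Ring.NaturalCoefficients.Default as SemiringSolver
open import Data.Fin.Base using (Fin; zero; suc; toℕ; punchIn)
open import Data.Fin.Properties using (toℕ<n)
open import Data.Integer.Base as ℤ using (+_)
import Data.Integer.Properties as ℤₚ
open import Data.List.Base using (List; []; _∷_; map; length; _++_)
open import Data.List.Properties using (length-++)
import Data.Maybe.Base as Maybe
open import Data.Nat.Base as ℕ using (ℕ; zero; suc; _∸_; _<_; _≤_; s≤s; z≤n; _!)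
open import Data.Nat.Combinatorics using (_C_; nC1≡n; nCk+nC[k+1]≡[n+1]C[k+1])
import Data.Nat.Properties as ℕₚ
open import Data.Nat.Solver using (module +-*-Solver)
open import Data.Product.Base using (∃; _×_; _,_; proj₁; proj₂)
open import Data.Rational.Base as ℚ using (ℚ; 0ℚ; 1ℚ; _/_; toℚᵘ)
import Data.Rational.Properties as ℚₚ
open import Data.Rational.Unnormalised.Base as ℚᵘ using (mkℚᵘ; *≡*)
import Data.Rational.Unnormalised.Properties as ℚᵘₚ
open import Data.Sum.Base using (_⊎_; inj₁; inj₂)
open import Data.Vec.Functional as Vector using ()
open import Defs using (module Determinant; Polynomial; coeff; ℚ[x]; _+ₚ_; _*ₚ_; const; x; nat; factorialRatio)
open import Function.Base using (_∘_; id)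
open import Level using (0ℓ)
open import Relation.Binary.Core using (Rel)
open import Relation.Binary.PropositionalEquality.Core as ≡ using (_≡_; _≢_)
import Relation.Binary.PropositionalEquality.Properties as ≡
import Relation.Binary.Reasoning.Setoid as SetoidReasoning
open import Relation.Nullary using (yes; no; contradiction)
open import Relation.Nullary.Decidable using (dec⇒maybe)
open import Algebra.Properties.CommutativeMonoid.Sum ℕₚ.+-0-commutativeMonoid as ℕ-sum
  using () renaming (sum to sumℕ)

-- Power series

-- The product peels off the constant term of the left factor, as in f = f 0 + t (f ∘ suc). The
-- construction serves twice: over ℚ it yields the ring laws of ℚ[x], and over an algebra it holds
-- the generating functions.
seriesRawRing : RawRing 0ℓ 0ℓ → RawRing 0ℓ 0ℓ
seriesRawRing R = record
  { Carrier = ℕ → Carrier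
  ; _≈_     = λ f g → ∀ m → f m ≈ g m
  ; _+_     = λ f g m → f m + g m
  ; _*_     = _⊛_
  ; -_      = λ f m → - f m
  ; 0#      = λ _ → 0#
  ; 1#      = one
  }
  where
  open RawRing R

  _⊛_ : (ℕ → Carrier) → (ℕ → Carrier) → ℕ → Carrier
  (f ⊛ g) zero    = f 0 * g 0
  (f ⊛ g) (suc m) = f 0 * g (suc m) + ((f ∘ suc) ⊛ g) m

  one : ℕ → Carrier
  one zero    = 1#
  one (suc _) = 0#

module _ (R : CommutativeRing 0ℓ 0ℓ) where
  open CommutativeRing R hiding (zero)
  open RawRing (seriesRawRing rawRing) using ()
    renaming (Carrier to Series; _≈_ to _≋_; _*_ to _⊛_; _+_ to _⊞_; 1# to one)
  open SetoidReasoning setoid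
  private
    interchange : ∀ a b c d → (a + b) + (c + d) ≈ (a + c) + (b + d)
    interchange a b c d = begin
      (a + b) + (c + d) ≈⟨ +-assoc a b (c + d) ⟩
      a + (b + (c + d)) ≈⟨ +-congˡ (+-assoc b c d) ⟨
      a + ((b + c) + d) ≈⟨ +-congˡ (+-congʳ (+-comm b c)) ⟩
      a + ((c + b) + d) ≈⟨ +-congˡ (+-assoc c b d) ⟩
      a + (c + (b + d)) ≈⟨ +-assoc a c (b + d) ⟨
      (a + c) + (b + d) ∎

  ⊛-cong : ∀ {f f′ g g′} → f ≋ f′ → g ≋ g′ → (f ⊛ g) ≋ (f′ ⊛ g′)
  ⊛-cong p q zero    = *-cong (p 0) (q 0)
  ⊛-cong p q (suc m) = +-cong (*-cong (p 0) (q (suc m))) (⊛-cong (p ∘ suc) q m)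

  -- The defining recursion treats the two factors differently; commutativity needs its mirror
  -- image, which peels the right factor.
  ⊛-sucʳ : ∀ f g m → (f ⊛ g) (suc m) ≈ (f ⊛ (g ∘ suc)) m + f (suc m) * g 0
  ⊛-sucʳ f g zero    = refl
  ⊛-sucʳ f g (suc m) = begin
    f 0 * g (suc (suc m)) + ((f ∘ suc) ⊛ g) (suc m)
      ≈⟨ +-congˡ (⊛-sucʳ (f ∘ suc) g m) ⟩
    f 0 * g (suc (suc m)) + (((f ∘ suc) ⊛ (g ∘ suc)) m + f (suc (suc m)) * g 0)
      ≈⟨ +-assoc _ _ _ ⟨
    (f ⊛ (g ∘ suc)) (suc m) + f (suc (suc m)) * g 0 ∎

  ⊛-comm : ∀ f g → (f ⊛ g) ≋ (g ⊛ f)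
  ⊛-comm f g zero    = *-comm (f 0) (g 0)
  ⊛-comm f g (suc m) = begin
    f 0 * g (suc m) + ((f ∘ suc) ⊛ g) m ≈⟨ +-cong (*-comm _ _) (⊛-comm (f ∘ suc) g m) ⟩
    g (suc m) * f 0 + (g ⊛ (f ∘ suc)) m ≈⟨ +-comm _ _ ⟩
    (g ⊛ (f ∘ suc)) m + g (suc m) * f 0 ≈⟨ ⊛-sucʳ g f m ⟨
    (g ⊛ f) (suc m)                     ∎

  ⊛-distribʳ : ∀ h f g → ((f ⊞ g) ⊛ h) ≋ ((f ⊛ h) ⊞ (g ⊛ h))
  ⊛-distribʳ h f g zero    = distribʳ (h 0) (f 0) (g 0)
  ⊛-distribʳ h f g (suc m) = begin
    (f 0 + g 0) * h (suc m) + (((f ∘ suc) ⊞ (g ∘ suc)) ⊛ h) m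
      ≈⟨ +-cong (distribʳ _ _ _) (⊛-distribʳ h (f ∘ suc) (g ∘ suc) m) ⟩
    (f 0 * h (suc m) + g 0 * h (suc m)) + (((f ∘ suc) ⊛ h) m + ((g ∘ suc) ⊛ h) m)
      ≈⟨ interchange _ _ _ _ ⟩
    (f ⊛ h) (suc m) + (g ⊛ h) (suc m) ∎

  ⊛-scale : ∀ a f g → ((λ m → a * f m) ⊛ g) ≋ (λ m → a * (f ⊛ g) m)
  ⊛-scale a f g zero    = *-assoc _ _ _
  ⊛-scale a f g (suc m) =
    trans (+-cong (*-assoc _ _ _) (⊛-scale a (f ∘ suc) g m)) (sym (distribˡ _ _ _))

  ⊛-assoc : ∀ f g h → ((f ⊛ g) ⊛ h) ≋ (f ⊛ (g ⊛ h))
  ⊛-assoc f g h zero    = *-assoc _ _ _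
  ⊛-assoc f g h (suc m) = begin
    (f 0 * g 0) * h (suc m) + ((((λ l → f 0 * g (suc l)) ⊞ ((f ∘ suc) ⊛ g))) ⊛ h) m
      ≈⟨ +-cong (*-assoc _ _ _) (⊛-distribʳ h _ _ m) ⟩
    f 0 * (g 0 * h (suc m)) + (((λ l → f 0 * g (suc l)) ⊛ h) m + (((f ∘ suc) ⊛ g) ⊛ h) m)
      ≈⟨ +-congˡ (+-cong (⊛-scale (f 0) (g ∘ suc) h m) (⊛-assoc (f ∘ suc) g h m)) ⟩
    f 0 * (g 0 * h (suc m)) + (f 0 * ((g ∘ suc) ⊛ h) m + ((f ∘ suc) ⊛ (g ⊛ h)) m)
      ≈⟨ +-assoc _ _ _ ⟨
    (f 0 * (g 0 * h (suc m)) + f 0 * ((g ∘ suc) ⊛ h) m) + ((f ∘ suc) ⊛ (g ⊛ h)) m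
      ≈⟨ +-congʳ (distribˡ _ _ _) ⟨
    (f ⊛ (g ⊛ h)) (suc m) ∎

  ⊛-zeroˡ : ∀ g → ((λ _ → 0#) ⊛ g) ≋ (λ _ → 0#)
  ⊛-zeroˡ g zero    = zeroˡ _
  ⊛-zeroˡ g (suc m) = trans (+-cong (zeroˡ _) (⊛-zeroˡ g m)) (+-identityˡ _)

  ⊛-identityˡ : ∀ g → (one ⊛ g) ≋ g
  ⊛-identityˡ g zero    = *-identityˡ _
  ⊛-identityˡ g (suc m) = trans (+-cong (*-identityˡ _) (⊛-zeroˡ g m)) (+-identityʳ _)

  seriesRing : CommutativeRing 0ℓ 0ℓ
  seriesRing = record
    { RawRing (seriesRawRing rawRing)
    ; isCommutativeRing = record
      { isRing = record
        { +-isAbelianGroup = record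
          { isGroup = record
            { isMonoid = record
              { isSemigroup = record
                { isMagma = record
                  { isEquivalence = record
                    { refl  = λ _ → refl
                    ; sym   = λ p m → sym (p m)
                    ; trans = λ p q m → trans (p m) (q m)
                    }
                  ; ∙-cong = λ p q m → +-cong (p m) (q m)
                  }
                ; assoc = λ f g h m → +-assoc _ _ _
                }
              ; identity = (λ f m → +-identityˡ _) , (λ f m → +-identityʳ _)
              }
            ; inverse = (λ f m → -‿inverseˡ _) , (λ f m → -‿inverseʳ _)
            ; ⁻¹-cong = λ p m → -‿cong (p m)
            }
          ; comm = λ f g m → +-comm _ _
          }
        ; *-cong = ⊛-cong
        ; *-assoc = ⊛-assoc
        ; *-identity = ⊛-identityˡ , λ f m → trans (⊛-comm f one m) (⊛-identityˡ f m)
        ; distrib = (λ h f g m → trans (⊛-comm h (f ⊞ g) m)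
                      (trans (⊛-distribʳ h f g m) (+-cong (⊛-comm f h m) (⊛-comm g h m))))
                  , ⊛-distribʳ
        }
      ; *-comm = ⊛-comm
      }
    }

-- Determinants

module DeterminantProperties {c ℓ} (R : CommutativeRing c ℓ) where
  open CommutativeRing R hiding (zero)
  open RawSemiringDefinitions (RawRing.rawSemiring rawRing) using (_^_; product)
  open Determinant rawRing using (det)
  open SemiringSum semiring using (sum; sum-cong-≋; ∑-distrib-+; *-distribˡ-sum; sum-replicate-zero)
  open SetoidReasoning setoid
  open SemiringSolver commutativeSemiring using (solve; _:=_; _:+_; _:*_; con)

  private
    sum-zero : ∀ {n} {f : Fin n → Carrier} → (∀ i → f i ≈ 0#) → sum f ≈ 0#
    sum-zero {n} p = trans (sum-cong-≋ p) (sum-replicate-zero n)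

  det-cong : ∀ {n} {A B : Fin n → Fin n → Carrier} →
             (∀ i j → A i j ≈ B i j) → det A ≈ det B
  det-cong {zero}  p = refl
  det-cong {suc n} p = sum-cong-≋ λ j → *-congˡ {(- 1#) ^ toℕ j}
    (*-cong (p zero j) (det-cong λ r s → p (suc r) (punchIn j s)))

  det-scaleRows : ∀ {n} (d : Fin n → Carrier) A →
                  det (λ i j → d i * A i j) ≈ product d * det A
  det-scaleRows {zero}  d A = sym (*-identityˡ 1#)
  det-scaleRows {suc n} d A = begin
    sum (λ j → (- 1#) ^ toℕ j * (d zero * A zero j * det (λ r s → d (suc r) * A (suc r) (punchIn j s))))
      ≈⟨ sum-cong-≋ (λ j → trans
           (*-congˡ {(- 1#) ^ toℕ j} (*-congˡ (det-scaleRows (d ∘ suc) λ r s → A (suc r) (punchIn j s))))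
           (solve 5 (λ e a b p m → e :* (a :* b :* (p :* m)) := a :* p :* (e :* (b :* m))) refl
             ((- 1#) ^ toℕ j) (d zero) (A zero j) (product (d ∘ suc)) _)) ⟩
    sum (λ j → product d * ((- 1#) ^ toℕ j * (A zero j * det (λ r s → A (suc r) (punchIn j s)))))
      ≈⟨ *-distribˡ-sum (product d) (λ j → (- 1#) ^ toℕ j * (A zero j * det (λ r s → A (suc r) (punchIn j s)))) ⟨
    product d * det A ∎

  -- The first term contains an entry of the zero column; in every later term the minor keeps that
  -- column as its first.
  det-zeroColumn : ∀ {n} (A : Fin (suc n) → Fin (suc n) → Carrier) →
                   (∀ i → A i zero ≈ 0#) → det A ≈ 0#
  det-zeroColumn {n} A p = sum-zero λ j → trans (*-congˡ {(- 1#) ^ toℕ j} (term j)) (zeroʳ _)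
    where
    term : ∀ j → A zero j * det (λ r s → A (suc r) (punchIn j s)) ≈ 0#
    term zero = trans (*-congʳ (p zero)) (zeroˡ _)
    term (suc {suc _} j) =
      trans (*-congˡ (det-zeroColumn (λ r s → A (suc r) (punchIn (suc j) s)) (p ∘ suc))) (zeroʳ _)

  det-upperTriangular : ∀ {n} (A : Fin n → Fin n → Carrier) →
                        (∀ i j → toℕ j ℕ.< toℕ i → A i j ≈ 0#) →
                        det A ≈ product (λ i → A i i)
  det-upperTriangular {zero}  A p = refl
  det-upperTriangular {suc n} A p = begin
    1# * (A zero zero * det (λ r s → A (suc r) (suc s))) + sum laterTerm
      ≈⟨ +-cong
           (trans (*-identityˡ _) (*-congˡ
             (det-upperTriangular (λ r s → A (suc r) (suc s)) λ i j i<j → p (suc i) (suc j) (ℕ.s≤s i<j))))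
           (sum-zero {f = laterTerm} λ j →
             trans (*-congˡ {(- 1#) ^ suc (toℕ j)} (trans (*-congˡ (minor A p j)) (zeroʳ _))) (zeroʳ _)) ⟩
    product (λ i → A i i) + 0# ≈⟨ +-identityʳ _ ⟩
    product (λ i → A i i) ∎
    where
    laterTerm : Fin n → Carrier
    laterTerm j = (- 1#) ^ suc (toℕ j) * (A zero (suc j) * det (λ r s → A (suc r) (punchIn (suc j) s)))

    minor : ∀ {m} (A : Fin (suc m) → Fin (suc m) → Carrier) →
            (∀ i j → toℕ j ℕ.< toℕ i → A i j ≈ 0#) →
            ∀ j → det (λ r s → A (suc r) (punchIn (suc j) s)) ≈ 0#
    minor {suc m} A p j =
      det-zeroColumn (λ r s → A (suc r) (punchIn (suc j) s)) λ i → p (suc i) zero (ℕ.s≤s ℕ.z≤n)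

  -- Expansion along the first two rows v and w; G f is the minor of the
  -- remaining rows in the columns selected by f.
  twoRows : ∀ {n} → ((Fin n → Fin (suc (suc n))) → Carrier) →
            (v w : Fin (suc (suc n)) → Carrier) → Carrier
  twoRows G v w = sum λ j → (- 1#) ^ toℕ j * (v j * sum λ s → (- 1#) ^ toℕ s *
    (w (punchIn j s) * G (λ i → punchIn j (punchIn s i))))

  private
    oneRow : ∀ {n} → ((Fin n → Fin (suc (suc n))) → Carrier) →
             (Fin (suc (suc n)) → Carrier) → Carrier
    oneRow G w = sum λ s → (- 1#) ^ toℕ s * (w (suc s) * G (λ i → suc (punchIn s i)))

    laterRows : ∀ {n} → ((Fin n → Fin (suc (suc n))) → Carrier) →
                (v w : Fin (suc (suc n)) → Carrier) → Carrier
    laterRows G v w = sum λ j → (- 1#) ^ toℕ j * (v (suc j) * sum λ s → (- 1#) ^ toℕ s *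
      (w (suc (punchIn j s)) * G (λ i → punchIn (suc j) (punchIn (suc s) i))))

    e² : (- 1#) * (- 1#) ≈ 1#
    e² = trans (RingProperties.-1*x≈-x ring (- 1#)) (RingProperties.-‿involutive ring 1#)

    cancel : ∀ a → a + (- 1#) * a ≈ 0#
    cancel a = trans (+-congˡ (RingProperties.-1*x≈-x ring a)) (-‿inverseʳ a)

    -- The two rows use two different columns. Once the choices involving column 0 are split off,
    -- the rest has the same shape on the columns after 0, which opens the way to induction on the
    -- number of columns.
    twoRows-peel : ∀ {n} G (v w : Fin (suc (suc n)) → Carrier) →
      twoRows G v w ≈ v zero * oneRow G w + (- 1#) * (w zero * oneRow G v) + laterRows G v w
    twoRows-peel {n} G v w = begin
      twoRows G v w
        ≈⟨ +-cong (*-identityˡ (v zero * oneRow G w)) (sum-cong-≋ term) ⟩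
      v zero * oneRow G w + sum (λ j → (- 1#) * (w zero * single j) + later j)
        ≈⟨ +-congˡ (∑-distrib-+ (λ j → (- 1#) * (w zero * single j)) later) ⟩
      v zero * oneRow G w + (sum (λ j → (- 1#) * (w zero * single j)) + laterRows G v w)
        ≈⟨ +-congˡ (+-congʳ (*-distribˡ-sum (- 1#) (λ j → w zero * single j))) ⟨
      v zero * oneRow G w + ((- 1#) * sum (λ j → w zero * single j) + laterRows G v w)
        ≈⟨ +-congˡ (+-congʳ (*-congˡ (*-distribˡ-sum (w zero) single))) ⟨
      v zero * oneRow G w + ((- 1#) * (w zero * oneRow G v) + laterRows G v w)
        ≈⟨ +-assoc _ _ _ ⟨
      v zero * oneRow G w + (- 1#) * (w zero * oneRow G v) + laterRows G v w ∎
      where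
      single later : Fin (suc n) → Carrier
      single j = (- 1#) ^ toℕ j * (v (suc j) * G (λ i → suc (punchIn j i)))
      inner : ∀ j → Fin n → Carrier
      inner j s = (- 1#) ^ toℕ s *
        (w (suc (punchIn j s)) * G (λ i → punchIn (suc j) (punchIn (suc s) i)))
      later j = (- 1#) ^ toℕ j * (v (suc j) * sum (inner j))

      term : ∀ j → _ ≈ (- 1#) * (w zero * single j) + later j
      term j = begin
        _ ≈⟨ *-congˡ {(- 1#) ^ toℕ (suc j)} (*-congˡ {v (suc j)} (+-congˡ (trans
               (sum-cong-≋ λ s → *-assoc (- 1#) ((- 1#) ^ toℕ s) (w (suc (punchIn j s)) * G (λ i → punchIn (suc j) (punchIn (suc s) i))))
               (sym (*-distribˡ-sum (- 1#) (inner j)))))) ⟩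
        (- 1#) * (- 1#) ^ toℕ j * (v (suc j) *
          (1# * (w zero * G (λ i → suc (punchIn j i))) + (- 1#) * sum (inner j)))
          ≈⟨ solve 6 (λ e f a b g t → e :* f :* (a :* (con 1 :* (b :* g) :+ e :* t))
                := e :* (b :* (f :* (a :* g))) :+ e :* e :* (f :* (a :* t))) refl
               (- 1#) ((- 1#) ^ toℕ j) (v (suc j)) (w zero) _ (sum (inner j)) ⟩
        (- 1#) * (w zero * single j) + (- 1#) * (- 1#) * later j
          -- Both column indices have moved up by one, and the two signs cancel.
          ≈⟨ +-congˡ (trans (*-congʳ e²) (*-identityˡ _)) ⟩
        (- 1#) * (w zero * single j) + later j ∎

    -- When neither of the first two rows uses column 0, the minor of the remaining rows does: this
    -- adds it to a selection from the other columns.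
    keepFirst : ∀ {m n} → (Fin m → Fin n) → Fin (suc m) → Fin (suc n)
    keepFirst f zero    = zero
    keepFirst f (suc i) = suc (f i)

    -- Selections that arise in two ways agree only pointwise, so the minor must be known to respect
    -- pointwise equality.
    Extensional : ∀ {m n} → ((Fin m → Fin n) → Carrier) → Set _
    Extensional G = ∀ {f g} → (∀ i → f i ≡ g i) → G f ≈ G g

    keepFirst-ext : ∀ {m n} {f g : Fin m → Fin n} → (∀ i → f i ≡ g i) →
                    ∀ i → keepFirst f i ≡ keepFirst g i
    keepFirst-ext p zero    = ≡.refl
    keepFirst-ext p (suc i) = ≡.cong suc (p i)

    laterRows-twoRows : ∀ {n} (G : (Fin (suc n) → Fin (suc (suc (suc n)))) → Carrier) →
      Extensional G → ∀ v w → laterRows G v w ≈ twoRows (G ∘ keepFirst) (v ∘ suc) (w ∘ suc)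
    laterRows-twoRows {n} G ext v w =
      sum-cong-≋ {suc (suc n)} λ j → *-congˡ {(- 1#) ^ toℕ j} (*-congˡ {v (suc j)} (sum-cong-≋ {suc n} λ s →
        *-congˡ {(- 1#) ^ toℕ s} (*-congˡ {w (suc (punchIn j s))} (ext
          {λ i → punchIn (suc j) (punchIn (suc s) i)}
          {keepFirst λ i → punchIn j (punchIn s i)}
          λ { zero → ≡.refl ; (suc i) → ≡.refl }))))

    laterRows-zero : ∀ G v w → laterRows {zero} G v w ≈ 0#
    laterRows-zero G v w =
      sum-zero {1} λ j → trans (*-congˡ {(- 1#) ^ toℕ j} (zeroʳ (v (suc j)))) (zeroʳ _)

  -- The two terms involving column 0 cancel and the rest is a smaller instance. Antisymmetry would
  -- give only 2 D = 0, which does not suffice in a general ring.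
  twoRows-alternating : ∀ {n} (G : (Fin n → Fin (suc (suc n))) → Carrier) → Extensional G →
                        ∀ v → twoRows G v v ≈ 0#
  twoRows-alternating {n} G ext v = begin
    twoRows G v v                ≈⟨ twoRows-peel G v v ⟩
    _ + (- 1#) * _ + laterRows G v v ≈⟨ +-cong (cancel (v zero * oneRow G v)) (later n G ext v) ⟩
    0# + 0#                      ≈⟨ +-identityˡ 0# ⟩
    0#                           ∎
    where
    later : ∀ n (G : (Fin n → Fin (suc (suc n))) → Carrier) → Extensional G →
            ∀ v → laterRows G v v ≈ 0#
    later zero    G ext v = laterRows-zero G v v
    later (suc n) G ext v = trans (laterRows-twoRows G ext v v)
      (twoRows-alternating (G ∘ keepFirst) (λ p → ext (keepFirst-ext p)) (v ∘ suc))

  twoRows-antisymmetric : ∀ {n} (G : (Fin n → Fin (suc (suc n))) → Carrier) → Extensional G →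
                          ∀ v w → twoRows G v w + twoRows G w v ≈ 0#
  twoRows-antisymmetric {n} G ext v w = begin
    twoRows G v w + twoRows G w v
      ≈⟨ +-cong (twoRows-peel G v w) (twoRows-peel G w v) ⟩
    _ ≈⟨ solve 5 (λ e a b c d → (a :+ e :* b :+ c) :+ (b :+ e :* a :+ d)
                      := (a :+ b) :+ e :* (a :+ b) :+ (c :+ d)) refl
           (- 1#) (v zero * oneRow G w) (w zero * oneRow G v) (laterRows G v w) (laterRows G w v) ⟩
    _ ≈⟨ +-cong (cancel (v zero * oneRow G w + w zero * oneRow G v)) (later n G ext v w) ⟩
    0# + 0# ≈⟨ +-identityˡ 0# ⟩
    0# ∎
    where
    later : ∀ n (G : (Fin n → Fin (suc (suc n))) → Carrier) → Extensional G →
            ∀ v w → laterRows G v w + laterRows G w v ≈ 0#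
    later zero    G ext v w =
      trans (+-cong (laterRows-zero G v w) (laterRows-zero G w v)) (+-identityˡ 0#)
    later (suc n) G ext v w =
      trans (+-cong (laterRows-twoRows G ext v w) (laterRows-twoRows G ext w v))
        (twoRows-antisymmetric (G ∘ keepFirst) (λ p → ext (keepFirst-ext p)) (v ∘ suc) (w ∘ suc))

  private
    twoRows-linearʳ : ∀ {n} G (v w u : Fin (suc (suc n)) → Carrier) a →
      twoRows G v (λ j → w j + a * u j) ≈ twoRows G v w + a * twoRows G v u
    twoRows-linearʳ {n} G v w u a = begin
      twoRows G v (λ j → w j + a * u j)
        ≈⟨ sum-cong-≋ (λ j → *-congˡ {(- 1#) ^ toℕ j} (*-congˡ {v j} (inner j))) ⟩
      sum (λ j → (- 1#) ^ toℕ j * (v j * (sum (row w j) + a * sum (row u j))))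
        ≈⟨ sum-cong-≋ (λ j → solve 5 (λ e b p q r → e :* (b :* (p :+ q :* r))
              := e :* (b :* p) :+ q :* (e :* (b :* r))) refl
              ((- 1#) ^ toℕ j) (v j) (sum (row w j)) a (sum (row u j))) ⟩
      sum (λ j → (- 1#) ^ toℕ j * (v j * sum (row w j)) + a * ((- 1#) ^ toℕ j * (v j * sum (row u j))))
        ≈⟨ ∑-distrib-+ (λ j → (- 1#) ^ toℕ j * (v j * sum (row w j)))
                       (λ j → a * ((- 1#) ^ toℕ j * (v j * sum (row u j)))) ⟩
      twoRows G v w + sum (λ j → a * ((- 1#) ^ toℕ j * (v j * sum (row u j))))
        ≈⟨ +-congˡ (*-distribˡ-sum a (λ j → (- 1#) ^ toℕ j * (v j * sum (row u j)))) ⟨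
      twoRows G v w + a * twoRows G v u ∎
      where
      row : (Fin (suc (suc n)) → Carrier) → ∀ j → Fin (suc n) → Carrier
      row w j s = (- 1#) ^ toℕ s * (w (punchIn j s) * G (λ i → punchIn j (punchIn s i)))

      inner : ∀ j → sum (row (λ j → w j + a * u j) j) ≈ sum (row w j) + a * sum (row u j)
      inner j = begin
        sum (row (λ j → w j + a * u j) j)
          ≈⟨ sum-cong-≋ (λ s → solve 5 (λ e p q r g → e :* ((p :+ q :* r) :* g)
               := e :* (p :* g) :+ q :* (e :* (r :* g))) refl
               ((- 1#) ^ toℕ s) (w (punchIn j s)) a (u (punchIn j s)) (G (λ i → punchIn j (punchIn s i)))) ⟩
        sum (λ s → row w j s + a * row u j s)
          ≈⟨ ∑-distrib-+ (row w j) (λ s → a * row u j s) ⟩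
        sum (row w j) + sum (λ s → a * row u j s)
          ≈⟨ +-congˡ (*-distribˡ-sum a (row u j)) ⟨
        sum (row w j) + a * sum (row u j) ∎

  -- In the row next to v, linearity and alternation remove the multiple of v. For the rows further
  -- down, the first two rows are exchanged, so that v heads every minor and induction applies; then
  -- they are exchanged back.
  det-addFirstRow : ∀ {n} (v : Fin (suc n) → Carrier) (w : Fin n → Fin (suc n) → Carrier)
                    (a : Fin n → Carrier) →
                    det (v Vector.∷ λ i j → w i j + a i * v j) ≈ det (v Vector.∷ w)
  det-addFirstRow {zero}  v w a = refl
  det-addFirstRow {suc n} v w a = begin
    twoRows G′ v (λ j → w zero j + a zero * v j) ≈⟨ twoRows-linearʳ G′ v (w zero) v (a zero) ⟩
    twoRows G′ v (w zero) + a zero * twoRows G′ v v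
      ≈⟨ +-congˡ (trans (*-congˡ (twoRows-alternating G′ ext′ v)) (zeroʳ _)) ⟩
    twoRows G′ v (w zero) + 0#                   ≈⟨ +-identityʳ _ ⟩
    twoRows G′ v (w zero)
      ≈⟨ RingProperties.+-inverseˡ-unique ring _ _ (twoRows-antisymmetric G′ ext′ v (w zero)) ⟩
    - twoRows G′ (w zero) v                      ≈⟨ -‿cong swapped ⟩
    - twoRows G (w zero) v
      ≈⟨ RingProperties.+-inverseˡ-unique ring _ _ (twoRows-antisymmetric G ext v (w zero)) ⟨
    twoRows G v (w zero)                         ∎
    where
    G G′ : (Fin n → Fin (suc (suc n))) → Carrier
    G  f = det λ r s → w (suc r) (f s)
    G′ f = det λ r s → w (suc r) (f s) + a (suc r) * v (f s)

    ext : Extensional G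
    ext p = det-cong λ r s → reflexive (≡.cong (w (suc r)) (p s))

    ext′ : Extensional G′
    ext′ p = det-cong λ r s → reflexive (≡.cong (λ j → w (suc r) j + a (suc r) * v j) (p s))

    swapped : twoRows G′ (w zero) v ≈ twoRows G (w zero) v
    swapped = sum-cong-≋ {suc (suc n)} λ j → *-congˡ {(- 1#) ^ toℕ j} (*-congˡ {w zero j} (minor j))
      where
      minor : ∀ j → det (λ r s → (v Vector.∷ λ i l → w (suc i) l + a (suc i) * v l) r (punchIn j s)) ≈
                    det (λ r s → (v Vector.∷ λ i → w (suc i)) r (punchIn j s))
      minor j = begin
        det (λ r s → (v Vector.∷ λ i l → w (suc i) l + a (suc i) * v l) r (punchIn j s))
          ≈⟨ restrict (λ i l → w (suc i) l + a (suc i) * v l) ⟩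
        det (vⱼ Vector.∷ λ r s → wⱼ r s + a (suc r) * vⱼ s)
          ≈⟨ det-addFirstRow vⱼ wⱼ (λ r → a (suc r)) ⟩
        det (vⱼ Vector.∷ wⱼ)
          ≈⟨ restrict (λ i → w (suc i)) ⟨
        det (λ r s → (v Vector.∷ λ i → w (suc i)) r (punchIn j s)) ∎
        where
        vⱼ : Fin (suc n) → Carrier
        vⱼ s = v (punchIn j s)
        wⱼ : Fin n → Fin (suc n) → Carrier
        wⱼ r s = w (suc r) (punchIn j s)

        restrict : ∀ u → det (λ r s → (v Vector.∷ u) r (punchIn j s)) ≈
                         det (vⱼ Vector.∷ λ r s → u r (punchIn j s))
        restrict u = det-cong {A = λ r s → (v Vector.∷ u) r (punchIn j s)} {B = vⱼ Vector.∷ λ r s → u r (punchIn j s)}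
          λ { zero _ → refl ; (suc r) _ → refl }

  -- Row 0 of the product is a multiple of row 0 of A, and its multiples can be cleared from the
  -- other rows. In the expansion along row 0 every minor is then again a lower triangular matrix
  -- times a minor of A.
  det-lowerTriangular-* : ∀ {n} (C A : Fin n → Fin n → Carrier) →
    (∀ i l → toℕ i ℕ.< toℕ l → C i l ≈ 0#) →
    det (λ i j → sum λ l → C i l * A l j) ≈ product (λ i → C i i) * det A
  det-lowerTriangular-* {zero}  C A p = sym (*-identityˡ 1#)
  det-lowerTriangular-* {suc n} C A p = begin
    det (λ i j → sum λ l → C i l * A l j)
      ≈⟨ det-cong rows ⟩
    det (λ i j → d i * (A zero Vector.∷ λ r j → w r j + C (suc r) zero * A zero j) i j)
      ≈⟨ det-scaleRows d (A zero Vector.∷ λ r j → w r j + C (suc r) zero * A zero j) ⟩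
    product d * det (A zero Vector.∷ λ r j → w r j + C (suc r) zero * A zero j)
      ≈⟨ *-cong (trans (*-congˡ (ones n)) (*-identityʳ _))
                (det-addFirstRow (A zero) w (λ r → C (suc r) zero)) ⟩
    C zero zero * det (A zero Vector.∷ w)
      ≈⟨ *-congˡ (sum-cong-≋ λ j → *-congˡ {(- 1#) ^ toℕ j} (*-congˡ {A zero j}
           (det-lowerTriangular-* (λ r s → C (suc r) (suc s)) (λ r s → A (suc r) (punchIn j s))
             λ i l i<l → p (suc i) (suc l) (ℕ.s≤s i<l)))) ⟩
    C zero zero * sum (λ j → (- 1#) ^ toℕ j * (A zero j * (diagonal * det (λ r s → A (suc r) (punchIn j s)))))
      ≈⟨ *-congˡ (sum-cong-≋ λ j → solve 4 (λ e a q m → e :* (a :* (q :* m)) := q :* (e :* (a :* m))) refl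
           ((- 1#) ^ toℕ j) (A zero j) diagonal (det (λ r s → A (suc r) (punchIn j s)))) ⟩
    C zero zero * sum (λ j → diagonal * ((- 1#) ^ toℕ j * (A zero j * det (λ r s → A (suc r) (punchIn j s)))))
      ≈⟨ *-congˡ (*-distribˡ-sum diagonal (λ j → (- 1#) ^ toℕ j * (A zero j * det (λ r s → A (suc r) (punchIn j s))))) ⟨
    C zero zero * (diagonal * det A)
      ≈⟨ *-assoc _ _ _ ⟨
    product (λ i → C i i) * det A ∎
    where
    diagonal : Carrier
    diagonal = product λ r → C (suc r) (suc r)

    w : Fin n → Fin (suc n) → Carrier
    w r j = sum λ l → C (suc r) (suc l) * A (suc l) j

    d : Fin (suc n) → Carrier
    d = C zero zero Vector.∷ λ _ → 1#

    ones : ∀ m → product {m} (λ _ → 1#) ≈ 1#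
    ones zero    = refl
    ones (suc m) = trans (*-identityˡ _) (ones m)

    rows : ∀ i j → sum (λ l → C i l * A l j) ≈
                   d i * (A zero Vector.∷ λ r j → w r j + C (suc r) zero * A zero j) i j
    rows zero j = trans
      (+-congˡ (sum-zero λ l → trans (*-congʳ (p zero (suc l) (ℕ.s≤s ℕ.z≤n))) (zeroˡ _)))
      (+-identityʳ _)
    rows (suc r) j = trans (+-comm _ _) (sym (*-identityˡ _))

-- ℚ-algebras

ℚ-ring : CommutativeRing 0ℓ 0ℓ
ℚ-ring = ℚₚ.+-*-commutativeRing

ℚ-rawRing : RawRing 0ℓ 0ℓ
ℚ-rawRing = CommutativeRing.rawRing ℚ-ring

coeff-+ : ∀ p q k → coeff (p +ₚ q) k ≡ coeff p k ℚ.+ coeff q k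
coeff-+ []      q       k       = ≡.sym (ℚₚ.+-identityˡ (coeff q k))
coeff-+ (a ∷ p) []      k       = ≡.sym (ℚₚ.+-identityʳ (coeff (a ∷ p) k))
coeff-+ (a ∷ p) (b ∷ q) zero    = ≡.refl
coeff-+ (a ∷ p) (b ∷ q) (suc k) = coeff-+ p q k

coeff-map : ∀ f → f 0ℚ ≡ 0ℚ → ∀ p k → coeff (map f p) k ≡ f (coeff p k)
coeff-map f f0 []      k       = ≡.sym f0
coeff-map f f0 (a ∷ p) zero    = ≡.refl
coeff-map f f0 (a ∷ p) (suc k) = coeff-map f f0 p k

coeff-scale : ∀ a p k → coeff (map (a ℚ.*_) p) k ≡ a ℚ.* coeff p k
coeff-scale a = coeff-map (a ℚ.*_) (ℚₚ.*-zeroʳ a)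

coeff-* : ∀ p q k → coeff (p *ₚ q) k ≡ RawRing._*_ (seriesRawRing ℚ-rawRing) (coeff p) (coeff q) k
coeff-* []      q k       = ≡.sym (⊛-zeroˡ ℚ-ring (coeff q) k)
coeff-* (a ∷ p) q zero    = ≡.trans (coeff-+ (map (a ℚ.*_) q) _ 0)
  (≡.trans (ℚₚ.+-identityʳ _) (coeff-scale a q 0))
coeff-* (a ∷ p) q (suc k) = ≡.trans (coeff-+ (map (a ℚ.*_) q) _ (suc k))
  (≡.cong₂ ℚ._+_ (coeff-scale a q (suc k)) (coeff-* p q k))

-- Equality of polynomials is by definition equality of coefficient functions, so injectivity is the
-- identity and ℚ[x] inherits its laws from the series over ℚ.
coeff-isRingMonomorphism : IsRingMonomorphism ℚ[x] (seriesRawRing ℚ-rawRing) coeff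
coeff-isRingMonomorphism = record
  { isRingHomomorphism = record
    { isSemiringHomomorphism = record
      { isNearSemiringHomomorphism = record
        { +-isMonoidHomomorphism = record
          { isMagmaHomomorphism = record
            { isRelHomomorphism = record { cong = id }
            ; homo = coeff-+
            }
          ; ε-homo = λ _ → ≡.refl
          }
        ; *-homo = coeff-*
        }
      ; 1#-homo = λ { zero → ≡.refl ; (suc _) → ≡.refl }
      }
    ; -‿homo = coeff-map (λ a → ℚ.- a) ≡.refl
    }
  ; injective = id
  }

polynomialRing : CommutativeRing 0ℓ 0ℓ
polynomialRing = record
  { RawRing ℚ[x]
  ; isCommutativeRing = RingMonomorphism.isCommutativeRing coeff-isRingMonomorphism
      (CommutativeRing.isCommutativeRing (seriesRing ℚ-ring))
  }

-- The same computations take place in ℚ, in ℚ[x], in series over an algebra and in quotients. The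
-- structure map also provides rational constants for the ring solver.
record ℚ-Algebra : Set₁ where
  field
    ring     : CommutativeRing 0ℓ 0ℓ
    morphism : ℚ-rawRing -Raw-AlmostCommutative⟶ fromCommutativeRing ring

  open CommutativeRing ring public hiding (ring; zero)
  open _-Raw-AlmostCommutative⟶_ morphism public using ()
    renaming (⟦_⟧ to ι; +-homo to ι-+; *-homo to ι-*; -‿homo to ι-neg; 0-homo to ι-0; 1-homo to ι-1)
  open RawSemiringDefinitions (RawRing.rawSemiring rawRing) public using (_^_; product)
  open SemiringSum semiring public
    using (sum; sum-cong-≋; ∑-distrib-+; *-distribˡ-sum; *-distribʳ-sum; sum-replicate-zero)

  num : ℕ → Carrier
  num k = ι (+ k / 1)

  module Solver = Algebra.Solver.Ring ℚ-rawRing (fromCommutativeRing ring) morphism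
    (λ a b → Maybe.map (reflexive ∘ ≡.cong ι) (dec⇒maybe (a ℚₚ.≟ b)))

ℚ-algebra : ℚ-Algebra
ℚ-algebra = record
  { ring     = ℚ-ring
  ; morphism = record
    { ⟦_⟧    = id
    ; +-homo = λ _ _ → ≡.refl
    ; *-homo = λ _ _ → ≡.refl
    ; -‿homo = λ _ → ≡.refl
    ; 0-homo = ≡.refl
    ; 1-homo = ≡.refl
    }
  }

polynomialAlgebra : ℚ-Algebra
polynomialAlgebra = record
  { ring     = polynomialRing
  ; morphism = record
    { ⟦_⟧    = const
    ; +-homo = λ _ _ _ → ≡.refl
    ; *-homo = λ { a b zero → ≡.sym (ℚₚ.+-identityʳ (a ℚ.* b)) ; a b (suc k) → ≡.refl }
    ; -‿homo = λ _ _ → ≡.refl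
    ; 0-homo = λ { zero → ≡.refl ; (suc k) → ≡.refl }
    ; 1-homo = λ _ → ≡.refl
    }
  }

private module P = ℚ-Algebra polynomialAlgebra

seriesAlgebra : ℚ-Algebra → ℚ-Algebra
seriesAlgebra A = record
  { ring     = seriesRing ring
  ; morphism = record
    { ⟦_⟧    = constant
    ; +-homo = λ { a b zero → ι-+ a b ; a b (suc m) → sym (+-identityˡ 0#) }
    ; *-homo = λ { a b zero → ι-* a b ; a b (suc m) → sym (trans (+-cong (zeroʳ _) (⊛-zeroˡ ring _ m)) (+-identityˡ 0#)) }
    ; -‿homo = λ { a zero → ι-neg a ; a (suc m) → sym (RingProperties.-0#≈0# (CommutativeRing.ring ring)) }
    ; 0-homo = λ { zero → ι-0 ; (suc m) → refl }
    ; 1-homo = λ { zero → ι-1 ; (suc m) → refl }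
    }
  }
  where
  open ℚ-Algebra A

  constant : ℚ → ℕ → Carrier
  constant a zero    = ι a
  constant a (suc _) = 0#

-- R / y R, on the carrier of R with a coarser equality.
quotientRing : (R : CommutativeRing 0ℓ 0ℓ) → CommutativeRing.Carrier R → CommutativeRing 0ℓ 0ℓ
quotientRing R y = record
  { RawRing rawRing
  ; _≈_ = _∼_
  ; isCommutativeRing = record
    { isRing = record
      { +-isAbelianGroup = record
        { isGroup = record
          { isMonoid = record
            { isSemigroup = record
              { isMagma = record
                { isEquivalence = record
                  { refl  = embed refl
                  ; sym   = ∼-sym
                  ; trans = ∼-trans
                  }
                ; ∙-cong = ∼-+
                }
              ; assoc = λ a b c → embed (+-assoc a b c)
              }
            ; identity = (λ a → embed (+-identityˡ a)) , (λ a → embed (+-identityʳ a))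
            }
          ; inverse = (λ a → embed (-‿inverseˡ a)) , (λ a → embed (-‿inverseʳ a))
          ; ⁻¹-cong = ∼-neg
          }
        ; comm = λ a b → embed (+-comm a b)
        }
      ; *-cong = ∼-*
      ; *-assoc = λ a b c → embed (*-assoc a b c)
      ; *-identity = (λ a → embed (*-identityˡ a)) , (λ a → embed (*-identityʳ a))
      ; distrib = (λ a b c → embed (distribˡ a b c)) , (λ a b c → embed (distribʳ a b c))
      }
    ; *-comm = λ a b → embed (*-comm a b)
    }
  }
  where
  open CommutativeRing R
  open RingProperties (CommutativeRing.ring R) using (-‿distribʳ-*; -‿+-comm)
  open SetoidReasoning setoid
  open SemiringSolver commutativeSemiring using (solve; _:=_; _:+_; _:*_)

  _∼_ : Carrier → Carrier → Set
  a ∼ b = ∃ λ q → a ≈ b + y * q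

  embed : ∀ {a b} → a ≈ b → a ∼ b
  embed p = 0# , trans p (sym (trans (+-congˡ (zeroʳ y)) (+-identityʳ _)))

  ∼-sym : ∀ {a b} → a ∼ b → b ∼ a
  ∼-sym {a} {b} (q , p) = - q , (begin
    b                       ≈⟨ +-identityʳ b ⟨
    b + 0#                  ≈⟨ +-congˡ (-‿inverseʳ (y * q)) ⟨
    b + (y * q + - (y * q)) ≈⟨ +-assoc _ _ _ ⟨
    (b + y * q) + - (y * q) ≈⟨ +-cong (sym p) (-‿distribʳ-* y q) ⟩
    a + y * - q             ∎)

  ∼-trans : ∀ {a b c} → a ∼ b → b ∼ c → a ∼ c
  ∼-trans {a} {b} {c} (q , p) (q′ , p′) = q′ + q , trans p (trans (+-congʳ p′)
    (solve 4 (λ c y q q′ → c :+ y :* q′ :+ y :* q := c :+ y :* (q′ :+ q)) refl c y q q′))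

  ∼-+ : ∀ {a b c d} → a ∼ b → c ∼ d → (a + c) ∼ (b + d)
  ∼-+ {a} {b} {c} {d} (q , p) (q′ , p′) = q + q′ , trans (+-cong p p′)
    (solve 5 (λ b d y q q′ → b :+ y :* q :+ (d :+ y :* q′) := b :+ d :+ y :* (q :+ q′)) refl b d y q q′)

  ∼-* : ∀ {a b c d} → a ∼ b → c ∼ d → (a * c) ∼ (b * d)
  ∼-* {a} {b} {c} {d} (q , p) (q′ , p′) = _ , trans (*-cong p p′)
    (solve 5 (λ b d y q q′ → (b :+ y :* q) :* (d :+ y :* q′)
       := b :* d :+ y :* (b :* q′ :+ q :* d :+ q :* (y :* q′))) refl b d y q q′)

  ∼-neg : ∀ {a b} → a ∼ b → (- a) ∼ (- b)
  ∼-neg {a} {b} (q , p) = - q , trans (-‿cong p)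
    (trans (sym (-‿+-comm b (y * q))) (+-congˡ (-‿distribʳ-* y q)))

-- With y = x + k this is the substitution x = - k, in a form where each vanishing comes with its
-- quotient by x + k as a witness.
quotientAlgebra : (A : ℚ-Algebra) → ℚ-Algebra.Carrier A → ℚ-Algebra
quotientAlgebra A y = record
  { ring     = quotientRing ring y
  ; morphism = record
    { ⟦_⟧    = ι
    ; +-homo = λ a b → embed (ι-+ a b)
    ; *-homo = λ a b → embed (ι-* a b)
    ; -‿homo = λ a → embed (ι-neg a)
    ; 0-homo = embed ι-0
    ; 1-homo = embed ι-1
    }
  }
  where
  open ℚ-Algebra A
  embed : ∀ {a b} → a ≈ b → ∃ λ q → a ≈ b + y * q
  embed p = 0# , trans p (sym (trans (+-congˡ (zeroʳ y)) (+-identityʳ _)))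

-- Natural numbers and fractions in ℚ

fromℚᵘ-homo-+ : ∀ p q → ℚ.fromℚᵘ (p ℚᵘ.+ q) ≡ ℚ.fromℚᵘ p ℚ.+ ℚ.fromℚᵘ q
fromℚᵘ-homo-+ p q = ℚₚ.toℚᵘ-injective (begin
  toℚᵘ (ℚ.fromℚᵘ (p ℚᵘ.+ q))                      ≈⟨ ℚₚ.toℚᵘ-fromℚᵘ (p ℚᵘ.+ q) ⟩
  p ℚᵘ.+ q ≈⟨ ℚᵘₚ.+-cong (ℚₚ.toℚᵘ-fromℚᵘ p) (ℚₚ.toℚᵘ-fromℚᵘ q) ⟨
  toℚᵘ (ℚ.fromℚᵘ p) ℚᵘ.+ toℚᵘ (ℚ.fromℚᵘ q) ≈⟨ ℚₚ.toℚᵘ-homo-+ (ℚ.fromℚᵘ p) (ℚ.fromℚᵘ q) ⟨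
  toℚᵘ (ℚ.fromℚᵘ p ℚ.+ ℚ.fromℚᵘ q) ∎)
  where open SetoidReasoning ℚᵘₚ.≃-setoid

fromℚᵘ-homo-* : ∀ p q → ℚ.fromℚᵘ (p ℚᵘ.* q) ≡ ℚ.fromℚᵘ p ℚ.* ℚ.fromℚᵘ q
fromℚᵘ-homo-* p q = ℚₚ.toℚᵘ-injective (begin
  toℚᵘ (ℚ.fromℚᵘ (p ℚᵘ.* q))                      ≈⟨ ℚₚ.toℚᵘ-fromℚᵘ (p ℚᵘ.* q) ⟩
  p ℚᵘ.* q ≈⟨ ℚᵘₚ.*-cong (ℚₚ.toℚᵘ-fromℚᵘ p) (ℚₚ.toℚᵘ-fromℚᵘ q) ⟨
  toℚᵘ (ℚ.fromℚᵘ p) ℚᵘ.* toℚᵘ (ℚ.fromℚᵘ q) ≈⟨ ℚₚ.toℚᵘ-homo-* (ℚ.fromℚᵘ p) (ℚ.fromℚᵘ q) ⟨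
  toℚᵘ (ℚ.fromℚᵘ p ℚ.* ℚ.fromℚᵘ q) ∎)
  where open SetoidReasoning ℚᵘₚ.≃-setoid

fromℚᵘ-cong : ∀ {p q} → p ℚᵘ.≃ q → ℚ.fromℚᵘ p ≡ ℚ.fromℚᵘ q
fromℚᵘ-cong {p} {q} = ℚₚ.fromℚᵘ-cong {p} {q}

fromℕ-+ : ∀ a b → + (a ℕ.+ b) / 1 ≡ (+ a / 1) ℚ.+ (+ b / 1)
fromℕ-+ a b = ≡.trans
  (fromℚᵘ-cong {mkℚᵘ (+ (a ℕ.+ b)) 0} {mkℚᵘ (+ a) 0 ℚᵘ.+ mkℚᵘ (+ b) 0} (*≡* (≡.cong (ℤ._* + 1)
    (≡.sym (≡.cong₂ ℤ._+_ (ℤₚ.*-identityʳ (+ a)) (ℤₚ.*-identityʳ (+ b)))))))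
  (fromℚᵘ-homo-+ (mkℚᵘ (+ a) 0) (mkℚᵘ (+ b) 0))

fromℕ-* : ∀ a b → + (a ℕ.* b) / 1 ≡ (+ a / 1) ℚ.* (+ b / 1)
fromℕ-* a b = ≡.trans
  (fromℚᵘ-cong {mkℚᵘ (+ (a ℕ.* b)) 0} {mkℚᵘ (+ a) 0 ℚᵘ.* mkℚᵘ (+ b) 0}
    (*≡* (≡.cong (ℤ._* + 1) (ℤₚ.pos-* a b))))
  (fromℚᵘ-homo-* (mkℚᵘ (+ a) 0) (mkℚᵘ (+ b) 0))

/-*-cancel : ∀ i n .{{_ : ℕ.NonZero n}} → (i / n) ℚ.* (+ n / 1) ≡ i / 1
/-*-cancel i (suc n) = ≡.trans (≡.sym (fromℚᵘ-homo-* (mkℚᵘ i n) (mkℚᵘ (+ suc n) 0)))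
  (fromℚᵘ-cong {mkℚᵘ i n ℚᵘ.* mkℚᵘ (+ suc n) 0} {mkℚᵘ i 0}
    (*≡* (≡.trans (ℤₚ.*-identityʳ _) (≡.cong (i ℤ.*_) (≡.cong (+_ ∘ suc) (≡.sym (ℕₚ.*-identityʳ n)))))))

-- Evaluation of polynomials in an algebra

module Evaluation (A : ℚ-Algebra) (b : ℚ-Algebra.Carrier A) where
  open ℚ-Algebra A
  open SetoidReasoning setoid
  open Solver using (solve; _:=_; _:+_; _:*_)

  eval : Polynomial → Carrier
  eval []      = 0#
  eval (a ∷ p) = ι a + b * eval p

  eval-+ : ∀ p q → eval (p P.+ q) ≈ eval p + eval q
  eval-+ []      q       = sym (+-identityˡ _)
  eval-+ (a ∷ p) []      = sym (+-identityʳ _)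
  eval-+ (a ∷ p) (c ∷ q) = begin
    ι (a ℚ.+ c) + b * eval (p P.+ q)        ≈⟨ +-cong (ι-+ a c) (*-congˡ (eval-+ p q)) ⟩
    (ι a + ι c) + b * (eval p + eval q)
      ≈⟨ solve 5 (λ a c b p q → (a :+ c) :+ b :* (p :+ q) := (a :+ b :* p) :+ (c :+ b :* q)) refl
           (ι a) (ι c) b (eval p) (eval q) ⟩
    (ι a + b * eval p) + (ι c + b * eval q) ∎

  eval-scale : ∀ a p → eval (map (a ℚ.*_) p) ≈ ι a * eval p
  eval-scale a []      = sym (zeroʳ _)
  eval-scale a (c ∷ p) = begin
    ι (a ℚ.* c) + b * eval (map (a ℚ.*_) p) ≈⟨ +-cong (ι-* a c) (*-congˡ (eval-scale a p)) ⟩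
    ι a * ι c + b * (ι a * eval p)
      ≈⟨ solve 4 (λ a c b p → a :* c :+ b :* (a :* p) := a :* (c :+ b :* p)) refl (ι a) (ι c) b (eval p) ⟩
    ι a * (ι c + b * eval p)                ∎

  eval-* : ∀ p q → eval (p P.* q) ≈ eval p * eval q
  eval-* []      q = sym (zeroˡ _)
  eval-* (a ∷ p) q = begin
    eval (map (a ℚ.*_) q +ₚ (0ℚ ∷ (p *ₚ q)))   ≈⟨ eval-+ (map (a ℚ.*_) q) (0ℚ ∷ (p *ₚ q)) ⟩
    eval (map (a ℚ.*_) q) + (ι 0ℚ + b * eval (p *ₚ q))
      ≈⟨ +-cong (eval-scale a q) (+-cong ι-0 (*-congˡ (eval-* p q))) ⟩
    ι a * eval q + (0# + b * (eval p * eval q))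
      ≈⟨ +-congˡ (+-identityˡ _) ⟩
    ι a * eval q + b * (eval p * eval q)
      ≈⟨ solve 4 (λ a b p q → a :* q :+ b :* (p :* q) := (a :+ b :* p) :* q) refl (ι a) b (eval p) (eval q) ⟩
    (ι a + b * eval p) * eval q ∎

  eval-const : ∀ a → eval (const a) ≈ ι a
  eval-const a = trans (+-congˡ (zeroʳ b)) (+-identityʳ _)

  eval-neg : ∀ p → eval (P.- p) ≈ - eval p
  eval-neg []      = sym (trans (sym (+-identityˡ _)) (-‿inverseʳ 0#))
  eval-neg (a ∷ p) = begin
    ι (ℚ.- a) + b * eval (P.- p) ≈⟨ +-cong (ι-neg a) (*-congˡ (eval-neg p)) ⟩
    - ι a + b * - eval p
      ≈⟨ solve 3 (λ a b p → Solver.:- a :+ b :* (Solver.:- p) := Solver.:- (a :+ b :* p)) refl (ι a) b (eval p) ⟩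
    - (ι a + b * eval p) ∎

  eval-x : eval x ≈ b
  eval-x = begin
    ι 0ℚ + b * (ι 1ℚ + b * 0#) ≈⟨ +-cong ι-0 (*-congˡ (+-cong ι-1 (zeroʳ b))) ⟩
    0# + b * (1# + 0#)         ≈⟨ +-identityˡ _ ⟩
    b * (1# + 0#)              ≈⟨ *-congˡ (+-identityʳ 1#) ⟩
    b * 1#                     ≈⟨ *-identityʳ b ⟩
    b                          ∎

  eval-^ : ∀ p n → eval (p P.^ n) ≈ eval p ^ n
  eval-^ p zero    = trans (eval-const 1ℚ) ι-1
  eval-^ p (suc n) = trans (eval-* p (p P.^ n)) (*-congˡ (eval-^ p n))

  eval-product : ∀ {n} (f : Fin n → Polynomial) → eval (P.product f) ≈ product (λ i → eval (f i))
  eval-product {zero}  f = trans (eval-const 1ℚ) ι-1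
  eval-product {suc n} f =
    trans (eval-* (f zero) (P.product (f ∘ suc))) (*-congˡ (eval-product (f ∘ suc)))

  -- The bound n concerns the degree and not the length of the list. All rows of an n by n matrix
  -- can thus be expanded in the same n powers.
  eval-expand : ∀ n p → (∀ k → n ≤ k → coeff p k ≡ 0ℚ) →
                eval p ≈ sum {n} (λ l → ι (coeff p (toℕ l)) * b ^ toℕ l)
  eval-expand zero    []      h = refl
  eval-expand (suc n) []      h =
    sym (trans (sum-cong-≋ {suc n} λ l → trans (*-congʳ ι-0) (zeroˡ (b ^ toℕ l))) (sum-replicate-zero (suc n)))
  eval-expand zero    (a ∷ p) h = begin
    ι a + b * eval p
      ≈⟨ +-cong (trans (reflexive (≡.cong ι (h 0 z≤n))) ι-0) (*-congˡ (eval-expand 0 p λ k _ → h (suc k) z≤n)) ⟩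
    0# + b * 0# ≈⟨ +-identityˡ _ ⟩
    b * 0#      ≈⟨ zeroʳ b ⟩
    0#          ∎
  eval-expand (suc n) (a ∷ p) h = +-cong (sym (*-identityʳ _)) (begin
    b * eval p
      ≈⟨ *-congˡ (eval-expand n p λ k n≤k → h (suc k) (s≤s n≤k)) ⟩
    b * sum {n} (λ l → ι (coeff p (toℕ l)) * b ^ toℕ l)
      ≈⟨ *-distribˡ-sum b (λ (l : Fin n) → ι (coeff p (toℕ l)) * b ^ toℕ l) ⟩
    sum {n} (λ l → b * (ι (coeff p (toℕ l)) * b ^ toℕ l))
      ≈⟨ sum-cong-≋ {n} (λ l → solve 3 (λ b c q → b :* (c :* q) := c :* (b :* q)) refl
           b (ι (coeff p (toℕ l))) (b ^ toℕ l)) ⟩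
    sum {n} (λ l → ι (coeff p (toℕ l)) * (b * b ^ toℕ l)) ∎)

-- Degree bounds with top coefficient

module _ where
  open ℚ-Algebra polynomialAlgebra

  -- p has degree at most d, and c is its coefficient at d (possibly 0).
  record Leading (d : ℕ) (c : ℚ) (p : Polynomial) : Set where
    constructor leading
    field
      top   : coeff p d ≡ c
      above : ∀ k → d < k → coeff p k ≡ 0ℚ

  open Leading public

  Leading-cong : ∀ {d c p q} → p ≈ q → Leading d c p → Leading d c q
  Leading-cong p≈q (leading t a) =
    leading (≡.trans (≡.sym (p≈q _)) t) λ k d<k → ≡.trans (≡.sym (p≈q k)) (a k d<k)

  Leading-+ : ∀ {d c e p q} → Leading d c p → Leading d e q → Leading d (c ℚ.+ e) (p + q)
  Leading-+ {p = p} {q} (leading t a) (leading t′ a′) =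
    leading (≡.trans (coeff-+ p q _) (≡.cong₂ ℚ._+_ t t′))
            λ k d<k → ≡.trans (coeff-+ p q k) (≡.cong₂ ℚ._+_ (a k d<k) (a′ k d<k))

  Leading-0 : ∀ d → Leading d 0ℚ 0#
  Leading-0 d = leading ≡.refl λ _ _ → ≡.refl

  Leading-const : ∀ a → Leading 0 a (const a)
  Leading-const a = leading ≡.refl λ { (suc k) _ → ≡.refl }

  -- Lower-order terms enter a sum in this way: they fit the larger bound and contribute 0 to the
  -- top coefficient.
  Leading-raise : ∀ {d c p} → Leading d c p → Leading (suc d) 0ℚ p
  Leading-raise (leading t a) = leading (a _ ℕₚ.≤-refl) λ k d<k → a k (ℕₚ.<⇒≤ d<k)

  Leading-neg : ∀ {d c p} → Leading d c p → Leading d (ℚ.- c) (- p)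
  Leading-neg {p = p} (leading t a) =
    leading (≡.trans (coeff-map (λ a → ℚ.- a) ≡.refl p _) (≡.cong (λ a → ℚ.- a) t))
            λ k d<k → ≡.trans (coeff-map (λ a → ℚ.- a) ≡.refl p k) (≡.cong (λ a → ℚ.- a) (a k d<k))

  Leading-* : ∀ {d e c c′ p q} → Leading d c p → Leading e c′ q → Leading (d ℕ.+ e) (c ℚ.* c′) (p * q)
  Leading-* {d} {e} {c} {c′} {p} {q} (leading t a) (leading t′ a′) = leading
    (≡.trans (coeff-* p q (d ℕ.+ e)) (≡.trans (⊛-top d (coeff p) a) (≡.cong₂ ℚ._*_ t t′)))
    (λ k d+e<k → ≡.trans (coeff-* p q k) (⊛-above d (coeff p) a k d+e<k))
    where
    open RawRing (seriesRawRing ℚ-rawRing) using () renaming (_*_ to _⊛_)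
    g : ℕ → ℚ
    g = coeff q

    ⊛-degree0 : ∀ f → (∀ k → 0 < k → f k ≡ 0ℚ) → ∀ k → (f ⊛ g) k ≡ f 0 ℚ.* g k
    ⊛-degree0 f a zero    = ≡.refl
    ⊛-degree0 f a (suc k) = ≡.trans
      (≡.cong (f 0 ℚ.* g (suc k) ℚ.+_) (≡.trans
        (⊛-cong ℚ-ring {g = g} (λ m → a (suc m) (s≤s z≤n)) (λ _ → ≡.refl) k) (⊛-zeroˡ ℚ-ring g k)))
      (ℚₚ.+-identityʳ _)

    ⊛-above : ∀ d f → (∀ k → d < k → f k ≡ 0ℚ) → ∀ k → d ℕ.+ e < k → (f ⊛ g) k ≡ 0ℚ
    ⊛-above zero    f a k       e<k = ≡.trans (⊛-degree0 f a k) (≡.trans (≡.cong (f 0 ℚ.*_) (a′ k e<k)) (ℚₚ.*-zeroʳ (f 0)))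
    ⊛-above (suc d) f a (suc k) (s≤s d+e<k) = ≡.trans
      (≡.cong₂ ℚ._+_
        (≡.trans (≡.cong (f 0 ℚ.*_) (a′ (suc k) (s≤s (ℕₚ.≤-trans (ℕₚ.m≤n+m e d) (ℕₚ.<⇒≤ d+e<k))))) (ℚₚ.*-zeroʳ (f 0)))
        (⊛-above d (f ∘ suc) (λ k d<k → a (suc k) (s≤s d<k)) k d+e<k))
      (ℚₚ.+-identityʳ 0ℚ)

    ⊛-top : ∀ d f → (∀ k → d < k → f k ≡ 0ℚ) → (f ⊛ g) (d ℕ.+ e) ≡ f d ℚ.* g e
    ⊛-top zero    f a = ⊛-degree0 f a e
    ⊛-top (suc d) f a = ≡.trans
      (≡.cong₂ ℚ._+_
        (≡.trans (≡.cong (f 0 ℚ.*_) (a′ (suc (d ℕ.+ e)) (s≤s (ℕₚ.m≤n+m e d)))) (ℚₚ.*-zeroʳ (f 0)))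
        (⊛-top d (f ∘ suc) λ k d<k → a (suc k) (s≤s d<k)))
      (ℚₚ.+-identityˡ _)

  Leading-x : Leading 1 1ℚ x
  Leading-x = leading ≡.refl λ { (suc (suc k)) _ → ≡.refl ; (suc zero) (s≤s ()) }

  Leading-x+ : ∀ a → Leading 1 1ℚ (x + const a)
  Leading-x+ a = Leading-+ Leading-x (Leading-raise (Leading-const a))

  Leading-^ : ∀ {p} → Leading 1 1ℚ p → ∀ n → Leading n 1ℚ (p ^ n)
  Leading-^ l zero    = Leading-const 1ℚ
  Leading-^ l (suc n) = Leading-* l (Leading-^ l n)

  Leading-product : ∀ {n} (f : Fin n → Polynomial) → (∀ i → Leading 1 1ℚ (f i)) →
                    Leading n 1ℚ (product f)
  Leading-product {zero}  f l = Leading-const 1ℚ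
  Leading-product {suc n} f l = Leading-* (l zero) (Leading-product (f ∘ suc) (l ∘ suc))

fromℕ-injective : ∀ {a b} → + a / 1 ≡ + b / 1 → a ≡ b
fromℕ-injective {a} {b} p =
  cancel-denominators (ℚₚ.fromℚᵘ-injective {mkℚᵘ (+ a) 0} {mkℚᵘ (+ b) 0} p)
  where
  cancel-denominators : mkℚᵘ (+ a) 0 ℚᵘ.≃ mkℚᵘ (+ b) 0 → a ≡ b
  cancel-denominators (*≡* q) =
    ℤₚ.+-injective (≡.trans (≡.sym (ℤₚ.*-identityʳ (+ a))) (≡.trans q (ℤₚ.*-identityʳ (+ b))))

-- Linear factors

-- The inverse i is the Bézout coefficient for x + k and x + l: i (x + k) - i (x + l) = 1.
fromℕ-apart : ∀ {k l} → k ≢ l → ∃ λ i → i ℚ.* ((+ k / 1) ℚ.- (+ l / 1)) ≡ 1ℚ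
fromℕ-apart {k} {l} k≢l = ℚ.1/ δ , ℚₚ.*-inverseˡ δ
  where
  δ : ℚ
  δ = (+ k / 1) ℚ.- (+ l / 1)

  instance
    δ≢0 : ℚ.NonZero δ
    δ≢0 = ℚ.≢-nonZero λ δ≡0 → k≢l (fromℕ-injective
      (RingProperties.x∙y⁻¹≈ε⇒x≈y (CommutativeRing.ring ℚ-ring) (+ k / 1) (+ l / 1) δ≡0))

occurrences : ℕ → List ℕ → ℕ
occurrences k []       = 0
occurrences k (l ∷ ls) with k ℕₚ.≟ l
... | yes _ = suc (occurrences k ls)
... | no  _ = occurrences k ls

occurrences-here : ∀ k ls → occurrences k (k ∷ ls) ≡ suc (occurrences k ls)
occurrences-here k ls with k ℕₚ.≟ k
... | yes _  = ≡.refl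
... | no k≢k = contradiction ≡.refl k≢k

occurrences-there : ∀ {k l} ls → k ≢ l → occurrences k (l ∷ ls) ≡ occurrences k ls
occurrences-there {k} {l} ls k≢l with k ℕₚ.≟ l
... | yes k≡l = contradiction k≡l k≢l
... | no _    = ≡.refl

occurrences-++ : ∀ k ls ms → occurrences k (ls ++ ms) ≡ occurrences k ls ℕ.+ occurrences k ms
occurrences-++ k []       ms = ≡.refl
occurrences-++ k (l ∷ ls) ms with k ℕₚ.≟ l
... | yes _ = ≡.cong suc (occurrences-++ k ls ms)
... | no  _ = occurrences-++ k ls ms

-- The one property of the indeterminate that the factor arguments use; it lets several factors be
-- taken out one after the other in an abstract algebra.
LinearCancellation : (A : ℚ-Algebra) → ℚ-Algebra.Carrier A → Set
LinearCancellation A x = ∀ k a b → (x + num k) * a ≈ (x + num k) * b → a ≈ b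
  where open ℚ-Algebra A

module LinearFactors (A : ℚ-Algebra) (x : ℚ-Algebra.Carrier A)
  (lin-cancel : LinearCancellation A x) where
  open ℚ-Algebra A
  open SetoidReasoning setoid
  open Solver using (solve; _:=_; _:+_; _:*_; _:-_)

  lin : ℕ → Carrier
  lin k = x + num k

  linProduct : List ℕ → Carrier
  linProduct []       = 1#
  linProduct (k ∷ ks) = lin k * linProduct ks

  linProduct-++ : ∀ ks ls → linProduct (ks ++ ls) ≈ linProduct ks * linProduct ls
  linProduct-++ []       ls = sym (*-identityˡ (linProduct ls))
  linProduct-++ (k ∷ ks) ls =
    trans (*-congˡ {lin k} (linProduct-++ ks ls)) (sym (*-assoc (lin k) (linProduct ks) (linProduct ls)))

  -- With i inverse to k - l, a = i ((x + k) a - (x + l) a), and both terms in the bracket are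
  -- multiples of x + l.
  lin-coprime : ∀ {k l} → k ≢ l → ∀ {a b} → lin k * a ≈ lin l * b → ∃ λ c → a ≈ lin l * c
  lin-coprime {k} {l} k≢l {a} {b} h = ι i * (b - a) , (begin
    a                           ≈⟨ *-identityˡ a ⟨
    1# * a                      ≈⟨ *-congʳ (trans (sym ι-1) (reflexive (≡.cong ι (≡.sym iδ≡1)))) ⟩
    ι (i ℚ.* δ) * a             ≈⟨ *-congʳ (trans (ι-* i δ) (*-congˡ (trans (ι-+ _ _) (+-congˡ (ι-neg _))))) ⟩
    (ι i * (num k - num l)) * a
      ≈⟨ solve 5 (λ i k l x a → (i :* (k :- l)) :* a := i :* ((x :+ k) :* a :- (x :+ l) :* a)) refl
           (ι i) (num k) (num l) x a ⟩
    ι i * (lin k * a - lin l * a) ≈⟨ *-congˡ (+-congʳ h) ⟩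
    ι i * (lin l * b - lin l * a)
      ≈⟨ solve 4 (λ i l a b → i :* (l :* b :- l :* a) := l :* (i :* (b :- a))) refl (ι i) (lin l) a b ⟩
    lin l * (ι i * (b - a))     ∎)
    where
    δ i : ℚ
    δ = (+ k / 1) ℚ.- (+ l / 1)
    i = proj₁ (fromℕ-apart k≢l)

    iδ≡1 : i ℚ.* δ ≡ 1ℚ
    iδ≡1 = proj₂ (fromℕ-apart k≢l)

  -- Coprimality takes one factor x + l out of a; cancelling it on both sides lowers m.
  lin-^-coprime : ∀ {k l} → k ≢ l → ∀ m {a b} → lin k * a ≈ lin l ^ m * b →
                  ∃ λ c → a ≈ lin l ^ m * c
  lin-^-coprime k≢l zero    {a} h = a , sym (*-identityˡ a)
  lin-^-coprime {k} {l} k≢l (suc m) {a} {b} h =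
    proj₁ rest , trans (proj₂ first)
      (trans (*-congˡ (proj₂ rest)) (sym (*-assoc (lin l) (lin l ^ m) (proj₁ rest))))
    where
    first : ∃ λ a′ → a ≈ lin l * a′
    first = lin-coprime k≢l (trans h (*-assoc (lin l) (lin l ^ m) b))

    rest : ∃ λ c → proj₁ first ≈ lin l ^ m * c
    rest = lin-^-coprime k≢l m {b = b} (lin-cancel l _ _ (begin
      lin l * (lin k * proj₁ first)
        ≈⟨ solve 3 (λ l k a → l :* (k :* a) := k :* (l :* a)) refl (lin l) (lin k) (proj₁ first) ⟩
      lin k * (lin l * proj₁ first)  ≈⟨ *-congˡ (proj₂ first) ⟨
      lin k * a                      ≈⟨ h ⟩
      lin l * lin l ^ m * b          ≈⟨ *-assoc (lin l) (lin l ^ m) b ⟩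
      lin l * (lin l ^ m * b)        ∎))

  -- After x + k is taken out, the quotient satisfies the hypothesis for the shorter list: at k one
  -- occurrence has been used up, and at any other l the power of x + l is coprime to x + k.
  linProduct-divides : ∀ ks {q} → (∀ k → ∃ λ c → q ≈ lin k ^ occurrences k ks * c) →
                       ∃ λ c → q ≈ linProduct ks * c
  linProduct-divides []       {q} h = q , sym (*-identityˡ q)
  linProduct-divides (k ∷ ks) {q} h =
    c , trans q≈ (trans (*-congˡ {lin k} q′≈) (sym (*-assoc (lin k) (linProduct ks) c)))
    where
    q′ : Carrier
    q′ = lin k ^ occurrences k ks * proj₁ (h k)

    q≈ : q ≈ lin k * q′
    q≈ = trans (proj₂ (h k)) (trans
      (*-congʳ (reflexive (≡.cong (lin k ^_) (occurrences-here k ks))))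
      (*-assoc (lin k) (lin k ^ occurrences k ks) (proj₁ (h k))))

    q′-divisible : ∀ l → ∃ λ c → q′ ≈ lin l ^ occurrences l ks * c
    q′-divisible l with l ℕₚ.≟ k
    ... | yes ≡.refl = proj₁ (h k) , refl
    ... | no  l≢k    = lin-^-coprime (l≢k ∘ ≡.sym) (occurrences l ks) (trans (sym q≈) (trans (proj₂ (h l))
      (*-congʳ (reflexive (≡.cong (lin l ^_) (occurrences-there ks l≢k))))))

    c : Carrier
    c = proj₁ (linProduct-divides ks q′-divisible)

    q′≈ : q′ ≈ linProduct ks * c
    q′≈ = proj₂ (linProduct-divides ks q′-divisible)


-- Cancelling linear factors in ℚ[x]

module _ where
  open ℚ-Algebra polynomialAlgebra

  coeff-bounded : ∀ p k → length p ≤ k → coeff p k ≡ 0ℚ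
  coeff-bounded []      k       _       = ≡.refl
  coeff-bounded (a ∷ p) (suc k) (s≤s h) = coeff-bounded p k h

  coeff-linear-* : ∀ a p → p ≈ a ∷ 1ℚ ∷ [] → ∀ q k →
                   coeff (p * q) (suc k) ≡ a ℚ.* coeff q (suc k) ℚ.+ coeff q k
  coeff-linear-* a p p≈ q k = ≡.trans (*-congʳ {q} {p} {a ∷ 1ℚ ∷ []} p≈ (suc k)) (≡.trans (coeff-* (a ∷ 1ℚ ∷ []) q (suc k))
    (≡.cong (a ℚ.* coeff q (suc k) ℚ.+_) (≡.trans
      (⊛-cong ℚ-ring {g = coeff q} (λ { zero → ≡.refl ; (suc _) → ≡.refl }) (λ _ → ≡.refl) k)
      (⊛-identityˡ ℚ-ring (coeff q) k))))

  -- Coefficient k of q is coefficient k + 1 of p q minus a times coefficient k + 1 of q. Zeros of q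
  -- therefore propagate downwards from the end of its list; the fuel counts the steps to that end.
  linear-*-vanish : ∀ a p → p ≈ a ∷ 1ℚ ∷ [] → ∀ q d →
    (∀ k → d ≤ k → coeff (p * q) (suc k) ≡ 0ℚ) → ∀ k → d ≤ k → coeff q k ≡ 0ℚ
  linear-*-vanish a p p≈ q d h k d≤k = go (length q) k d≤k (ℕₚ.m≤n+m (length q) k)
    where
    go : ∀ fuel k → d ≤ k → length q ≤ k ℕ.+ fuel → coeff q k ≡ 0ℚ
    go zero       k d≤k b = coeff-bounded q k (≡.subst (length q ≤_) (ℕₚ.+-identityʳ k) b)
    go (suc fuel) k d≤k b = ≡.trans (≡.sym (≡.trans
      (≡.cong (ℚ._+ coeff q k) (≡.trans
        (≡.cong (a ℚ.*_) (go fuel (suc k) (ℕₚ.m≤n⇒m≤1+n d≤k) (≡.subst (length q ≤_) (ℕₚ.+-suc k fuel) b)))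
        (ℚₚ.*-zeroʳ a)))
      (ℚₚ.+-identityˡ _))) (≡.trans (≡.sym (coeff-linear-* a p p≈ q k)) (h k d≤k))

  Leading-cancel : ∀ a p → p ≈ a ∷ 1ℚ ∷ [] → ∀ {d c} q →
                   Leading (suc d) c (p * q) → Leading d c q
  Leading-cancel a p p≈ {d} q (leading t h) = leading
    (≡.trans (≡.sym (≡.trans
      (≡.cong (ℚ._+ coeff q d) (≡.trans (≡.cong (a ℚ.*_) (above-q (suc d) ℕₚ.≤-refl)) (ℚₚ.*-zeroʳ a)))
      (ℚₚ.+-identityˡ _))) (≡.trans (≡.sym (coeff-linear-* a p p≈ q d)) t))
    above-q
    where
    above-q : ∀ k → d < k → coeff q k ≡ 0ℚ
    above-q = linear-*-vanish a p p≈ q (suc d) λ k d<k → h (suc k) (s≤s d<k)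


  x+nat-linear : ∀ k → x + nat k ≈ (+ k / 1) ∷ 1ℚ ∷ []
  x+nat-linear k zero          = ℚₚ.+-identityˡ _
  x+nat-linear k (suc zero)    = ≡.refl
  x+nat-linear k (suc (suc _)) = ≡.refl

  x+nat-cancel : LinearCancellation polynomialAlgebra x
  x+nat-cancel k a b h = RingProperties.x∙y⁻¹≈ε⇒x≈y (CommutativeRing.ring ring) a b λ m →
    linear-*-vanish (+ k / 1) (x + nat k) (x+nat-linear k) (a - b) 0
      (λ m _ → trans {(x + nat k) * (a - b)} {(x + nat k) * a - (x + nat k) * b} {0#}
        (RingProperties.x[y-z]≈xy-xz (CommutativeRing.ring ring) (x + nat k) a b)
        (RingProperties.x≈y⇒x∙y⁻¹≈ε (CommutativeRing.ring ring) {(x + nat k) * a} {(x + nat k) * b} h) (suc m))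
      m z≤n

  module ℚ[x]-factors = LinearFactors polynomialAlgebra x x+nat-cancel
  open ℚ[x]-factors using (linProduct)

  Leading-linProduct-cancel : ∀ ks {d c} q → Leading (length ks ℕ.+ d) c (linProduct ks * q) → Leading d c q
  Leading-linProduct-cancel []       q l = Leading-cong {p = 1# * q} {q} (*-identityˡ q) l
  Leading-linProduct-cancel (k ∷ ks) q l = Leading-linProduct-cancel ks q
    (Leading-cancel (+ k / 1) (x + nat k) (x+nat-linear k) (linProduct ks * q)
      (Leading-cong {p = (x + nat k) * linProduct ks * q} {(x + nat k) * (linProduct ks * q)}
        (*-assoc (x + nat k) (linProduct ks) q) l))

  Leading-x^-cancel : ∀ n {d c} q → Leading (n ℕ.+ d) c (x ^ n * q) → Leading d c q
  Leading-x^-cancel zero    q l = Leading-cong {p = 1# * q} {q} (*-identityˡ q) l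
  Leading-x^-cancel (suc n) q l = Leading-x^-cancel n q
    (Leading-cancel 0ℚ x (λ _ → ≡.refl) (x ^ n * q)
      (Leading-cong {p = x * x ^ n * q} {x * (x ^ n * q)} (*-assoc x (x ^ n) q) l))

-- Identities between t, σ and u

-- Chebyshev-like: cheb i at u is (4σ)ⁱ + Sⁱ, because u + 5 = 4σ + S and (4σ) S = 4.
cheb : ℕ → Polynomial
cheb zero          = nat 2
cheb (suc zero)    = x P.+ nat 5
cheb (suc (suc i)) = (x P.+ nat 5) P.* cheb (suc i) P.- nat 4 P.* cheb i

-- As in `cheb`, the indeterminate stands for u here and not for the x of the determinant.
rootPoly : ℕ → ℕ → Polynomial
rootPoly a p = (x P.+ nat 3) P.^ a P.* (x P.+ nat 1) P.^ p

IsGeometricSeries : (B : ℚ-Algebra) (t σ : ℚ-Algebra.Carrier B) → Set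
IsGeometricSeries B t σ = (1# - t) * σ ≈ 1#
  where open ℚ-Algebra B

module ShiftIdentities (B : ℚ-Algebra) (t σ : ℚ-Algebra.Carrier B)
  (inverse : IsGeometricSeries B t σ) where
  open ℚ-Algebra B
  open SetoidReasoning setoid
  open Solver using (solve; _:=_; _:+_; _:*_; _:-_; con)
  open Exp commutativeSemiring using (^-distrib-*; ^-homo-*; ^-congˡ)
  private
    c : ∀ {n} → ℕ → Solver.Polynomial n
    c k = con (+ k / 1)

  S u : Carrier
  S = 1# - t
  u = t * ((num 3 + t) * σ)

  open Evaluation B u

  private
    S≈ : S ≈ num 1 - t
    S≈ = +-congʳ (sym ι-1)

    inverse′ : (num 1 - t) * σ ≈ num 1
    inverse′ = trans (*-congʳ (+-congʳ ι-1)) (trans inverse (sym ι-1))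

  u*S : u * S ≈ t * (num 3 + t)
  u*S = begin
    t * ((num 3 + t) * σ) * S
      ≈⟨ solve 3 (λ t σ s → t :* ((c 3 :+ t) :* σ) :* s := t :* (c 3 :+ t) :* (s :* σ)) refl t σ S ⟩
    t * (num 3 + t) * (S * σ) ≈⟨ *-congˡ inverse ⟩
    t * (num 3 + t) * 1#      ≈⟨ *-identityʳ _ ⟩
    t * (num 3 + t)           ∎

  u+3 : (u + num 3) * S ≈ num 3 + t * t
  u+3 = begin
    (u + num 3) * S                       ≈⟨ distribʳ S u (num 3) ⟩
    u * S + num 3 * S                     ≈⟨ +-cong u*S (*-congˡ S≈) ⟩
    t * (num 3 + t) + num 3 * (num 1 - t)
      ≈⟨ solve 1 (λ t → t :* (c 3 :+ t) :+ c 3 :* (c 1 :- t) := c 3 :+ t :* t) refl t ⟩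
    num 3 + t * t                         ∎

  u+1 : (u + num 1) * (S * S * S) ≈ (num 1 - t * t) * (num 1 - t * t)
  u+1 = begin
    (u + num 1) * (S * S * S)
      ≈⟨ solve 2 (λ u s → (u :+ c 1) :* (s :* s :* s) := (u :* s :+ s) :* (s :* s)) refl u S ⟩
    (u * S + S) * (S * S)
      ≈⟨ *-cong (+-cong u*S S≈) (*-cong S≈ S≈) ⟩
    (t * (num 3 + t) + (num 1 - t)) * ((num 1 - t) * (num 1 - t))
      ≈⟨ solve 1 (λ t → (t :* (c 3 :+ t) :+ (c 1 :- t)) :* ((c 1 :- t) :* (c 1 :- t))
           := (c 1 :- t :* t) :* (c 1 :- t :* t)) refl t ⟩
    (num 1 - t * t) * (num 1 - t * t) ∎

  u+5 : u + num 5 ≈ num 4 * σ + S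
  u+5 = begin
    u + num 5
      -- The relation (1 - t) σ = 1 enters as a multiple of (1 - t) σ - 1. With the cofactor - t - 4
      -- the identity holds for independent t and σ, and the multiple then vanishes.
      ≈⟨ solve 2 (λ t σ → t :* ((c 3 :+ t) :* σ) :+ c 5 :=
           c 4 :* σ :+ (c 1 :- t) :+ ((c 1 :- t) :* σ :- c 1) :* (c 0 :- t :- c 4)) refl t σ ⟩
    num 4 * σ + (num 1 - t) + ((num 1 - t) * σ - num 1) * (num 0 - t - num 4)
      ≈⟨ +-cong (+-congˡ (sym S≈)) (trans (*-congʳ (trans (+-congʳ inverse′) (-‿inverseʳ (num 1)))) (zeroˡ _)) ⟩
    num 4 * σ + S + 0# ≈⟨ +-identityʳ _ ⟩
    num 4 * σ + S      ∎

  eval-x+nat : ∀ k → eval (x P.+ nat k) ≈ u + num k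
  eval-x+nat k = trans (eval-+ x (nat k)) (+-cong eval-x (eval-const (+ k / 1)))

  eval-cheb : ∀ i → eval (cheb i) ≈ num 4 ^ i * σ ^ i + S ^ i
  eval-cheb i = proj₁ (both i)
    where
    both : ∀ i → (eval (cheb i) ≈ num 4 ^ i * σ ^ i + S ^ i) ×
                 (eval (cheb (suc i)) ≈ num 4 ^ suc i * σ ^ suc i + S ^ suc i)
    both zero = (begin
        eval (nat 2)       ≈⟨ eval-const _ ⟩
        num 2              ≈⟨ solve 0 (c 2 := c 1 :* c 1 :+ c 1) refl ⟩
        num 1 * num 1 + num 1  ≈⟨ +-cong (*-cong ι-1 ι-1) ι-1 ⟩
        1# * 1# + 1#       ∎)
      , (begin
        eval (cheb 1)      ≈⟨ eval-x+nat 5 ⟩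
        u + num 5          ≈⟨ u+5 ⟩
        num 4 * σ + S      ≈⟨ +-cong (*-cong (*-identityʳ _) (*-identityʳ _)) (*-identityʳ _) ⟨
        num 4 * 1# * (σ * 1#) + S * 1# ∎)
    both (suc i) with both i
    ... | p , q = q , (begin
      eval (cheb (suc (suc i)))
        ≈⟨ trans (eval-+ ((x P.+ nat 5) P.* cheb (suc i)) (P.- (nat 4 P.* cheb i)))
             (+-cong (trans (eval-* (x P.+ nat 5) (cheb (suc i))) (*-cong (trans (eval-x+nat 5) u+5) q))
               (trans (eval-neg (nat 4 P.* cheb i)) (-‿cong (trans (eval-* (nat 4) (cheb i)) (*-cong (eval-const _) p))))) ⟩
      (num 4 * σ + S) * (num 4 * a * (σ * b) + S * d) - num 4 * (a * b + d)
        ≈⟨ solve 5 (λ a b d σ s → (c 4 :* σ :+ s) :* (c 4 :* a :* (σ :* b) :+ s :* d) :- c 4 :* (a :* b :+ d)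
             := c 4 :* (c 4 :* a) :* (σ :* (σ :* b)) :+ s :* (s :* d) :+ (s :* σ :- c 1) :* (c 4 :* d :+ c 4 :* (a :* b)))
             refl a b d σ S ⟩
      num 4 * (num 4 * a) * (σ * (σ * b)) + S * (S * d) + (S * σ - num 1) * (num 4 * d + num 4 * (a * b))
        ≈⟨ +-congˡ (trans (*-congʳ (trans (+-congʳ (trans inverse (sym ι-1))) (-‿inverseʳ (num 1)))) (zeroˡ _)) ⟩
      num 4 * (num 4 * a) * (σ * (σ * b)) + S * (S * d) + 0#
        ≈⟨ +-identityʳ _ ⟩
      num 4 ^ suc (suc i) * σ ^ suc (suc i) + S ^ suc (suc i) ∎)
      where
      a b d : Carrier
      a = num 4 ^ i
      b = σ ^ i
      d = S ^ i

  -- (u + 3) S and (u + 1) S³ are polynomials in t².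
  eval-rootPoly : ∀ a p → eval (rootPoly a p) * S ^ (a ℕ.+ (p ℕ.+ p ℕ.+ p)) ≈
                  (num 3 + t * t) ^ a * ((num 1 - t * t) * (num 1 - t * t)) ^ p
  eval-rootPoly a p = begin
    eval (rootPoly a p) * S ^ (a ℕ.+ (p ℕ.+ p ℕ.+ p))
      ≈⟨ *-cong (trans (eval-* ((x P.+ nat 3) P.^ a) ((x P.+ nat 1) P.^ p)) (*-cong (power 3 a) (power 1 p)))
           (trans (^-homo-* S a (p ℕ.+ p ℕ.+ p)) (*-congˡ (trans (^-homo-* S (p ℕ.+ p) p) (*-congʳ (^-homo-* S p p))))) ⟩
    ((u + num 3) ^ a * (u + num 1) ^ p) * (S ^ a * (S ^ p * S ^ p * S ^ p))
      ≈⟨ solve 4 (λ f g q r → (f :* g) :* (q :* (r :* r :* r)) := (f :* q) :* (g :* (r :* r :* r))) refl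
           ((u + num 3) ^ a) ((u + num 1) ^ p) (S ^ a) (S ^ p) ⟩
    ((u + num 3) ^ a * S ^ a) * ((u + num 1) ^ p * (S ^ p * S ^ p * S ^ p))
      ≈⟨ *-congˡ (*-congˡ (trans (^-distrib-* (S * S) S p) (*-congʳ (^-distrib-* S S p)))) ⟨
    ((u + num 3) ^ a * S ^ a) * ((u + num 1) ^ p * (S * S * S) ^ p)
      ≈⟨ *-cong (^-distrib-* (u + num 3) S a) (^-distrib-* (u + num 1) (S * S * S) p) ⟨
    ((u + num 3) * S) ^ a * ((u + num 1) * (S * S * S)) ^ p
      ≈⟨ *-cong (^-congˡ a u+3) (^-congˡ p u+1) ⟩
    (num 3 + t * t) ^ a * ((num 1 - t * t) * (num 1 - t * t)) ^ p ∎
    where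
    power : ∀ k a → eval ((x P.+ nat k) P.^ a) ≈ (u + num k) ^ a
    power k a = trans (eval-^ (x P.+ nat k) a) (^-congˡ a (eval-x+nat k))

-- Falling factorials and the binomial series

factorialRatio-! : ∀ m n → factorialRatio m n ℚ.* (+ (n !) / 1) ≡ + (m !) / 1
factorialRatio-! m n = /-*-cancel (+ (m !)) (n !) {{n ℕₚ.!≢0}}

factorialRatio-suc : ∀ m → factorialRatio 0 (suc m) ℚ.* (+ suc m / 1) ≡ factorialRatio 0 m
factorialRatio-suc m = begin
  r′ ℚ.* (+ suc m / 1)                              ≡⟨ ℚₚ.*-identityʳ _ ⟨
  r′ ℚ.* (+ suc m / 1) ℚ.* 1ℚ                       ≡⟨ ≡.cong (r′ ℚ.* (+ suc m / 1) ℚ.*_) (factorialRatio-! 0 m) ⟨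
  r′ ℚ.* (+ suc m / 1) ℚ.* (r ℚ.* (+ (m !) / 1))    ≡⟨ rearrange r′ (+ suc m / 1) r (+ (m !) / 1) ⟩
  r′ ℚ.* ((+ suc m / 1) ℚ.* (+ (m !) / 1)) ℚ.* r    ≡⟨ ≡.cong (λ k → r′ ℚ.* k ℚ.* r) (fromℕ-* (suc m) (m !)) ⟨
  r′ ℚ.* (+ (suc m !) / 1) ℚ.* r                    ≡⟨ ≡.cong (ℚ._* r) (factorialRatio-! 0 (suc m)) ⟩
  1ℚ ℚ.* r                                          ≡⟨ ℚₚ.*-identityˡ r ⟩
  r                                                 ∎
  where
  open ≡.≡-Reasoning
  open ℚ-Algebra.Solver ℚ-algebra
  r r′ : ℚ
  r  = factorialRatio 0 m
  r′ = factorialRatio 0 (suc m)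
  rearrange : ∀ a b c d → a ℚ.* b ℚ.* (c ℚ.* d) ≡ a ℚ.* (b ℚ.* d) ℚ.* c
  rearrange = solve 4 (λ a b c d → a :* b :* (c :* d) := a :* (b :* d) :* c) ≡.refl

module FallingFactorial (A : ℚ-Algebra) where
  open ℚ-Algebra A
  open SetoidReasoning setoid
  open Solver using (solve; _:=_; _:+_; _:*_; _:-_; con)

  num-+ : ∀ a b → num (a ℕ.+ b) ≈ num a + num b
  num-+ a b = trans (reflexive (≡.cong ι (fromℕ-+ a b))) (ι-+ _ _)

  num-suc : ∀ k → num (suc k) ≈ num k + 1#
  num-suc k = trans (num-+ 1 k) (trans (+-comm _ _) (+-congˡ ι-1))

  product-cong : ∀ {n} {f g : Fin n → Carrier} → (∀ i → f i ≈ g i) → product f ≈ product g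
  product-cong {zero}  p = refl
  product-cong {suc n} p = *-cong (p zero) (product-cong (p ∘ suc))

  product-last : ∀ n (f : ℕ → Carrier) → product {suc n} (f ∘ toℕ) ≈ product {n} (f ∘ toℕ) * f n
  product-last zero    f = *-comm _ _
  product-last (suc n) f = trans (*-congˡ (product-last n (f ∘ suc))) (sym (*-assoc _ _ _))

  product-* : ∀ {n} (f g : Fin n → Carrier) → product (λ i → f i * g i) ≈ product f * product g
  product-* {zero}  f g = sym (*-identityˡ 1#)
  product-* {suc n} f g = trans (*-congˡ (product-* (f ∘ suc) (g ∘ suc)))
    (solve 4 (λ a b c d → a :* b :* (c :* d) := a :* c :* (b :* d)) refl
      (f zero) (g zero) (product (f ∘ suc)) (product (g ∘ suc)))

  product-one : ∀ n → product {n} (λ _ → ι 1ℚ) ≈ 1#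
  product-one zero    = refl
  product-one (suc n) = trans (*-cong ι-1 (product-one n)) (*-identityˡ 1#)

  falling : Carrier → ℕ → Carrier
  falling α m = product {m} (λ k → α - num (toℕ k))

  falling-cong : ∀ {α β} m → α ≈ β → falling α m ≈ falling β m
  falling-cong m α≈β = product-cong {m} λ _ → +-congʳ α≈β

  falling-last : ∀ α m → falling α (suc m) ≈ falling α m * (α - num m)
  falling-last α m = product-last m (λ k → α - num k)

  falling-first : ∀ α m → falling (α + 1#) (suc m) ≈ (α + 1#) * falling α m
  falling-first α m = *-cong
    (trans (+-congʳ (+-congˡ (sym ι-1))) (trans (solve 1 (λ α → α :+ con 1ℚ :- con (+ 0 / 1) := α :+ con 1ℚ) refl α) (+-congˡ ι-1)))
    (product-cong {m} λ k → begin
      α + 1# - num (suc (toℕ k))      ≈⟨ +-cong (+-congˡ (sym ι-1)) (-‿cong (trans (num-suc (toℕ k)) (+-congˡ (sym ι-1)))) ⟩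
      α + ι 1ℚ - (num (toℕ k) + ι 1ℚ) ≈⟨ solve 2 (λ α k → α :+ con 1ℚ :- (k :+ con 1ℚ) := α :- k) refl α (num (toℕ k)) ⟩
      α - num (toℕ k)                 ∎)

  -- Over ℚ[x] this unfolds to `binomial` at a non-negative lower index. It is needed over quotients
  -- of ℚ[x] as well.
  gbinomial : Carrier → ℕ → Carrier
  gbinomial α m = ι (factorialRatio 0 m) * falling α m

  gbinomial-cong : ∀ {α β} m → α ≈ β → gbinomial α m ≈ gbinomial β m
  gbinomial-cong m α≈β = *-congˡ (falling-cong m α≈β)

  -- Pascal's rule at α = β + 1.
  gbinomial-pascal : ∀ β m → gbinomial (β + 1#) (suc m) - gbinomial β m ≈ gbinomial β (suc m)
  gbinomial-pascal β m = begin
    r′ * falling (β + 1#) (suc m) - ι (factorialRatio 0 m) * f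
      ≈⟨ +-cong (*-congˡ (trans (falling-first β m) (*-congʳ (+-congˡ (sym ι-1)))))
           (-‿cong (*-congʳ (trans (reflexive (≡.cong ι (≡.sym (factorialRatio-suc m))))
             (trans (ι-* _ _) (*-congˡ (trans (num-suc m) (+-congˡ (sym ι-1)))))))) ⟩
    r′ * ((β + ι 1ℚ) * f) - r′ * (num m + ι 1ℚ) * f
      ≈⟨ solve 4 (λ r β f m → r :* ((β :+ con 1ℚ) :* f) :- r :* (m :+ con 1ℚ) :* f := r :* (f :* (β :- m)))
           refl r′ β f (num m) ⟩
    r′ * (f * (β - num m)) ≈⟨ *-congˡ (falling-last β m) ⟨
    gbinomial β (suc m)    ∎
    where
    r′ f : Carrier
    r′ = ι (factorialRatio 0 (suc m))
    f = falling β m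

module BinomialSeries (A : ℚ-Algebra) where
  open ℚ-Algebra A
  open FallingFactorial A
  open SetoidReasoning setoid
  open Solver using (solve; _:=_; _:+_; _:*_; _:-_; :-_; con)
  module 𝕊 = ℚ-Algebra (seriesAlgebra A)

  t σ : 𝕊.Carrier
  t zero          = 0#
  t (suc zero)    = 1#
  t (suc (suc _)) = 0#
  σ _ = 1#

  t-suc : ∀ f m → (t 𝕊.* f) (suc m) ≈ f m
  t-suc f m = begin
    0# * f (suc m) + ((t ∘ suc) 𝕊.* f) m
      ≈⟨ +-cong (zeroˡ _) (⊛-cong ring {g = f} (λ { zero → refl ; (suc _) → refl }) (λ _ → refl) m) ⟩
    0# + (𝕊.1# 𝕊.* f) m ≈⟨ +-identityˡ _ ⟩
    (𝕊.1# 𝕊.* f) m      ≈⟨ 𝕊.*-identityˡ f m ⟩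
    f m                  ∎

  S-zero : ∀ f → ((𝕊.1# 𝕊.- t) 𝕊.* f) 0 ≈ f 0
  S-zero f = begin
    (1# - 0#) * f 0 ≈⟨ *-congʳ (+-congʳ (sym ι-1)) ⟩
    (ι 1ℚ - 0#) * f 0 ≈⟨ *-congʳ (+-congˡ (-‿cong (sym ι-0))) ⟩
    (ι 1ℚ - ι 0ℚ) * f 0 ≈⟨ solve 1 (λ f → (con 1ℚ :- con 0ℚ) :* f := f) refl (f 0) ⟩
    f 0 ∎

  S-suc : ∀ f m → ((𝕊.1# 𝕊.- t) 𝕊.* f) (suc m) ≈ f (suc m) - f m
  S-suc f m = begin
    ((𝕊.1# 𝕊.- t) 𝕊.* f) (suc m)
      ≈⟨ 𝕊.distribʳ f 𝕊.1# (𝕊.- t) (suc m) ⟩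
    (𝕊.1# 𝕊.* f) (suc m) + ((𝕊.- t) 𝕊.* f) (suc m)
      ≈⟨ +-cong (𝕊.*-identityˡ f (suc m))
           (sym (RingProperties.-‿distribˡ-* (CommutativeRing.ring 𝕊.ring) t f (suc m))) ⟩
    f (suc m) + - ((t 𝕊.* f) (suc m)) ≈⟨ +-congˡ (-‿cong (t-suc f m)) ⟩
    f (suc m) - f m ∎

  S*σ : (𝕊.1# 𝕊.- t) 𝕊.* σ 𝕊.≈ 𝕊.1#
  S*σ zero    = S-zero σ
  S*σ (suc m) = trans (S-suc σ m) (-‿inverseʳ 1#)

  open ShiftIdentities (seriesAlgebra A) t σ S*σ public using (S; u; eval-cheb; eval-rootPoly)
  open Evaluation (seriesAlgebra A) u public

  -- The series (1 - t)^(- α - 1), given by its coefficients; at α = x it is g.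
  binomialSeries : Carrier → 𝕊.Carrier
  binomialSeries α m = gbinomial (α + num m) m

  binomialSeries-cong : ∀ {α β} → α ≈ β → binomialSeries α 𝕊.≈ binomialSeries β
  binomialSeries-cong α≈β m = gbinomial-cong m (+-congʳ α≈β)

  -- Multiplication by 1 - t takes differences of consecutive coefficients, and Pascal's rule
  -- evaluates them.
  S*binomialSeries : ∀ α → S 𝕊.* binomialSeries α 𝕊.≈ binomialSeries (α - 1#)
  S*binomialSeries α zero    = S-zero (binomialSeries α)
  S*binomialSeries α (suc m) = begin
    (S 𝕊.* binomialSeries α) (suc m)
      ≈⟨ S-suc (binomialSeries α) m ⟩
    gbinomial (α + num (suc m)) (suc m) - gbinomial (α + num m) m
      ≈⟨ +-congʳ (gbinomial-cong (suc m) (trans (+-congˡ (num-suc m)) (sym (+-assoc _ _ _)))) ⟩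
    gbinomial (α + num m + 1#) (suc m) - gbinomial (α + num m) m
      ≈⟨ gbinomial-pascal (α + num m) m ⟩
    gbinomial (α + num m) (suc m)
      ≈⟨ gbinomial-cong (suc m) (sym (begin
           α - 1# + num (suc m)         ≈⟨ +-congˡ (num-suc m) ⟩
           α - 1# + (num m + 1#)        ≈⟨ +-cong (+-congˡ (-‿cong (sym ι-1))) (+-congˡ (sym ι-1)) ⟩
           α - ι 1ℚ + (num m + ι 1ℚ)    ≈⟨ solve 2 (λ α m → α :- con 1ℚ :+ (m :+ con 1ℚ) := α :+ m) refl α (num m) ⟩
           α + num m                    ∎)) ⟩
    binomialSeries (α - 1#) (suc m) ∎

  S^*binomialSeries : ∀ i α → S 𝕊.^ i 𝕊.* binomialSeries α 𝕊.≈ binomialSeries (α - num i)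
  S^*binomialSeries zero    α = 𝕊.trans (𝕊.*-identityˡ _) (binomialSeries-cong
    (solve 1 (λ α → α := α :- con (+ 0 / 1)) refl α))
  S^*binomialSeries (suc i) α = 𝕊.trans (𝕊.*-assoc S (S 𝕊.^ i) _)
    (𝕊.trans (𝕊.*-congˡ {S} (S^*binomialSeries i α))
    (𝕊.trans (S*binomialSeries (α - num i)) (binomialSeries-cong (begin
      α - num i - 1#       ≈⟨ +-congˡ (-‿cong (sym ι-1)) ⟩
      α - num i - ι 1ℚ     ≈⟨ solve 2 (λ α i → α :- i :- con 1ℚ := α :- (i :+ con 1ℚ)) refl α (num i) ⟩
      α - (num i + ι 1ℚ)   ≈⟨ +-congˡ (-‿cong (trans (num-suc i) (+-congˡ (sym ι-1)))) ⟨
      α - num (suc i)      ∎))))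

  -- The series at α + i is S times the one at α + i + 1, and σ S = 1.
  σ^*binomialSeries : ∀ i α → σ 𝕊.^ i 𝕊.* binomialSeries α 𝕊.≈ binomialSeries (α + num i)
  σ^*binomialSeries zero    α = 𝕊.trans (𝕊.*-identityˡ _) (binomialSeries-cong
    (solve 1 (λ α → α := α :+ con (+ 0 / 1)) refl α))
  σ^*binomialSeries (suc i) α = 𝕊.trans (𝕊.*-assoc σ (σ 𝕊.^ i) _)
    (𝕊.trans (𝕊.*-congˡ {σ} (𝕊.trans (σ^*binomialSeries i α)
      (𝕊.trans (binomialSeries-cong shift) (𝕊.sym (S*binomialSeries (α + num (suc i)))))))
    (𝕊.trans (𝕊.sym (𝕊.*-assoc σ S _))
    (𝕊.trans (𝕊.*-congʳ {binomialSeries (α + num (suc i))} (𝕊.trans (𝕊.*-comm σ S) S*σ)) (𝕊.*-identityˡ _))))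
    where
    shift : α + num i ≈ α + num (suc i) - 1#
    shift = sym (begin
      α + num (suc i) - 1#        ≈⟨ +-cong (+-congˡ (trans (num-suc i) (+-congˡ (sym ι-1)))) (-‿cong (sym ι-1)) ⟩
      α + (num i + ι 1ℚ) - ι 1ℚ   ≈⟨ solve 2 (λ α i → α :+ (i :+ con 1ℚ) :- con 1ℚ := α :+ i) refl α (num i) ⟩
      α + num i                   ∎)

  -- At α = - 1 the series is 1; multiplying by S lowers α by one. The hypothesis is an equation up
  -- to `_≈_` because the use is modulo x + k, where α is still the element x.
  binomialSeries-negative : ∀ κ α → α ≈ - num (suc κ) → binomialSeries α 𝕊.≈ S 𝕊.^ κ
  binomialSeries-negative κ α α≈ = 𝕊.sym (𝕊.trans (𝕊.sym (𝕊.*-identityʳ _))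
    (𝕊.trans (𝕊.*-congˡ {S 𝕊.^ κ} (𝕊.sym at-1))
    (𝕊.trans (S^*binomialSeries κ (- 1#)) (binomialSeries-cong (begin
      - 1# - num κ       ≈⟨ +-congʳ (-‿cong (sym ι-1)) ⟩
      - ι 1ℚ - num κ     ≈⟨ solve 1 (λ k → :- con 1ℚ :- k := :- (k :+ con 1ℚ)) refl (num κ) ⟩
      - (num κ + ι 1ℚ)   ≈⟨ -‿cong (trans (num-suc κ) (+-congˡ (sym ι-1))) ⟨
      - num (suc κ)      ≈⟨ α≈ ⟨
      α                  ∎)))))
    where
    at-1 : binomialSeries (- 1#) 𝕊.≈ 𝕊.1#
    at-1 zero    = trans (*-identityʳ _) ι-1
    at-1 (suc m) = begin
      ι (factorialRatio 0 (suc m)) * falling (- 1# + num (suc m)) (suc m)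
        -- The upper entry is m, so the last of the m + 1 factors is m - m.
        ≈⟨ *-congˡ (trans (falling-last _ m) (*-congˡ (begin
             - 1# + num (suc m) - num m          ≈⟨ +-congʳ (+-cong (-‿cong (sym ι-1)) (trans (num-suc m) (+-congˡ (sym ι-1)))) ⟩
             - ι 1ℚ + (num m + ι 1ℚ) - num m     ≈⟨ solve 1 (λ m → :- con 1ℚ :+ (m :+ con 1ℚ) :- m := con 0ℚ) refl (num m) ⟩
             ι 0ℚ                                ≈⟨ ι-0 ⟩
             0#                                  ∎))) ⟩
      ι (factorialRatio 0 (suc m)) * (_ * 0#) ≈⟨ *-congˡ (zeroʳ _) ⟩
      ι (factorialRatio 0 (suc m)) * 0#       ≈⟨ zeroʳ _ ⟩
      0# ∎

  constant-* : ∀ a f m → (𝕊.ι a 𝕊.* f) m ≈ ι a * f m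
  constant-* a f zero    = refl
  constant-* a f (suc m) = trans (+-congˡ (⊛-zeroˡ ring f m)) (+-identityʳ _)

  num^-* : ∀ k i f m → (𝕊.num k 𝕊.^ i 𝕊.* f) m ≈ num k ^ i * f m
  num^-* k zero    f m = trans (𝕊.*-identityˡ f m) (sym (*-identityˡ _))
  num^-* k (suc i) f m = begin
    (𝕊.num k 𝕊.* 𝕊.num k 𝕊.^ i 𝕊.* f) m   ≈⟨ 𝕊.*-assoc (𝕊.num k) (𝕊.num k 𝕊.^ i) f m ⟩
    (𝕊.num k 𝕊.* (𝕊.num k 𝕊.^ i 𝕊.* f)) m ≈⟨ constant-* (+ k / 1) _ m ⟩
    num k * (𝕊.num k 𝕊.^ i 𝕊.* f) m         ≈⟨ *-congˡ (num^-* k i f m) ⟩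
    num k * (num k ^ i * f m)                ≈⟨ *-assoc _ _ _ ⟨
    num k ^ suc i * f m                      ∎

  eval-cheb-* : ∀ i α m → (eval (cheb i) 𝕊.* binomialSeries α) m ≈
                num 4 ^ i * binomialSeries (α + num i) m + binomialSeries (α - num i) m
  eval-cheb-* i α m = begin
    (eval (cheb i) 𝕊.* g) m
      ≈⟨ 𝕊.*-congʳ {g} (eval-cheb i) m ⟩
    ((𝕊.num 4 𝕊.^ i 𝕊.* σ 𝕊.^ i 𝕊.+ S 𝕊.^ i) 𝕊.* g) m
      ≈⟨ 𝕊.distribʳ g (𝕊.num 4 𝕊.^ i 𝕊.* σ 𝕊.^ i) (S 𝕊.^ i) m ⟩
    (𝕊.num 4 𝕊.^ i 𝕊.* σ 𝕊.^ i 𝕊.* g) m + (S 𝕊.^ i 𝕊.* g) m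
      ≈⟨ +-cong (trans (𝕊.*-assoc (𝕊.num 4 𝕊.^ i) (σ 𝕊.^ i) g m)
                  (trans (num^-* 4 i (σ 𝕊.^ i 𝕊.* g) m) (*-congˡ (σ^*binomialSeries i α m))))
                (S^*binomialSeries i α m) ⟩
    num 4 ^ i * binomialSeries (α + num i) m + binomialSeries (α - num i) m ∎
    where
    g : 𝕊.Carrier
    g = binomialSeries α

  sum-at : ∀ {n} (f : Fin n → 𝕊.Carrier) m → 𝕊.sum f m ≡ sum (λ i → f i m)
  sum-at {zero}  f m = ≡.refl
  sum-at {suc n} f m = ≡.cong (λ s → f zero m + s) (sum-at (f ∘ suc) m)

  -- A polynomial in u thereby acts as a row operation on the coefficients of the series u^l f.
  eval-expand-* : ∀ n p f m → (∀ k → n ≤ k → coeff p k ≡ 0ℚ) →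
    (eval p 𝕊.* f) m ≈ sum {n} (λ l → ι (coeff p (toℕ l)) * (u 𝕊.^ toℕ l 𝕊.* f) m)
  eval-expand-* n p f m h = begin
    (eval p 𝕊.* f) m
      ≈⟨ 𝕊.*-congʳ {f} (eval-expand n p h) m ⟩
    (𝕊.sum {n} (λ l → 𝕊.ι (coeff p (toℕ l)) 𝕊.* u 𝕊.^ toℕ l) 𝕊.* f) m
      ≈⟨ 𝕊.*-distribʳ-sum f (λ (l : Fin n) → 𝕊.ι (coeff p (toℕ l)) 𝕊.* u 𝕊.^ toℕ l) m ⟩
    𝕊.sum {n} (λ l → 𝕊.ι (coeff p (toℕ l)) 𝕊.* u 𝕊.^ toℕ l 𝕊.* f) m
      ≡⟨ sum-at {n} (λ l → 𝕊.ι (coeff p (toℕ l)) 𝕊.* u 𝕊.^ toℕ l 𝕊.* f) m ⟩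
    sum {n} (λ l → (𝕊.ι (coeff p (toℕ l)) 𝕊.* u 𝕊.^ toℕ l 𝕊.* f) m)
      ≈⟨ sum-cong-≋ {n} (λ l → trans (𝕊.*-assoc (𝕊.ι (coeff p (toℕ l))) (u 𝕊.^ toℕ l) f m)
           (constant-* (coeff p (toℕ l)) (u 𝕊.^ toℕ l 𝕊.* f) m)) ⟩
    sum {n} (λ l → ι (coeff p (toℕ l)) * (u 𝕊.^ toℕ l 𝕊.* f) m) ∎

  Even : 𝕊.Carrier → Set
  Even f = ∀ m → f (suc (m ℕ.* 2)) ≈ 0#

  Even-cong : ∀ {f g} → f 𝕊.≈ g → Even f → Even g
  Even-cong f≈g e m = trans (sym (f≈g _)) (e m)

  Even-constant : ∀ a → Even (𝕊.ι a)
  Even-constant a m = refl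

  Even-+ : ∀ {f g} → Even f → Even g → Even (f 𝕊.+ g)
  Even-+ e e′ m = trans (+-cong (e m) (e′ m)) (+-identityˡ 0#)

  Even-neg : ∀ {f} → Even f → Even (𝕊.- f)
  Even-neg e m = trans (-‿cong (e m)) (RingProperties.-0#≈0# (CommutativeRing.ring ring))

  -- An odd index splits into an odd and an even one, so each product has a vanishing factor. The
  -- recursion removes two coefficients of f at a time to preserve parity.
  Even-* : ∀ {f g} → Even f → Even g → Even (f 𝕊.* g)
  Even-* {f} {g} e e′ zero    =
    trans (+-cong (trans (*-congˡ (e′ 0)) (zeroʳ _)) (trans (*-congʳ (e 0)) (zeroˡ _))) (+-identityˡ 0#)
  Even-* {f} {g} e e′ (suc m) = begin
    f 0 * g (3 ℕ.+ m ℕ.* 2) + (f 1 * g (2 ℕ.+ m ℕ.* 2) + ((λ k → f (2 ℕ.+ k)) 𝕊.* g) (suc (m ℕ.* 2)))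
      ≈⟨ +-cong (trans (*-congˡ (e′ (suc m))) (zeroʳ _))
           (+-cong (trans (*-congʳ (e 0)) (zeroˡ _)) (Even-* {λ k → f (2 ℕ.+ k)} {g} (λ k → e (suc k)) e′ m)) ⟩
    0# + (0# + 0#) ≈⟨ trans (+-identityˡ _) (+-identityˡ _) ⟩
    0# ∎

  Even-^ : ∀ {f} → Even f → ∀ n → Even (f 𝕊.^ n)
  Even-^ e zero    m = refl
  Even-^ {f} e (suc n) = Even-* {f} {f 𝕊.^ n} e (Even-^ {f} e n)

  Even-t² : Even (t 𝕊.* t)
  Even-t² zero    = t-suc t 0
  Even-t² (suc m) = t-suc t (2 ℕ.+ m ℕ.* 2)

  Even-rootPoly : ∀ a p α → α ≈ - num (suc (a ℕ.+ (p ℕ.+ p ℕ.+ p))) →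
                  Even (eval (rootPoly a p) 𝕊.* binomialSeries α)
  Even-rootPoly a p α α≈ = Even-cong
    {(𝕊.num 3 𝕊.+ t 𝕊.* t) 𝕊.^ a 𝕊.* ((𝕊.num 1 𝕊.- t 𝕊.* t) 𝕊.* (𝕊.num 1 𝕊.- t 𝕊.* t)) 𝕊.^ p}
    (𝕊.sym (𝕊.trans (𝕊.*-congˡ {eval (rootPoly a p)} (binomialSeries-negative (a ℕ.+ (p ℕ.+ p ℕ.+ p)) α α≈))
      (eval-rootPoly a p)))
    (Even-* {(𝕊.num 3 𝕊.+ t 𝕊.* t) 𝕊.^ a} (Even-^ {𝕊.num 3 𝕊.+ t 𝕊.* t} (Even-+ {𝕊.num 3} {t 𝕊.* t} (Even-constant (+ 3 / 1)) Even-t²) a)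
      (Even-^ {(𝕊.num 1 𝕊.- t 𝕊.* t) 𝕊.* (𝕊.num 1 𝕊.- t 𝕊.* t)}
        (Even-* {𝕊.num 1 𝕊.- t 𝕊.* t} {𝕊.num 1 𝕊.- t 𝕊.* t} 1-t² 1-t²) p))
    where
    1-t² : Even (𝕊.num 1 𝕊.- t 𝕊.* t)
    1-t² = Even-+ {𝕊.num 1} {𝕊.- (t 𝕊.* t)} (Even-constant (+ 1 / 1)) (Even-neg {t 𝕊.* t} Even-t²)

  binomialSeries-S : ∀ α → α ≈ - num 2 → ∀ m → binomialSeries α (suc (suc m)) ≈ 0#
  binomialSeries-S α α≈ m = begin
    binomialSeries α (suc (suc m))     ≈⟨ binomialSeries-negative 1 α α≈ (suc (suc m)) ⟩
    (S 𝕊.* 𝕊.1#) (suc (suc m))        ≈⟨ 𝕊.*-identityʳ S (suc (suc m)) ⟩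
    0# - 0#                            ≈⟨ -‿inverseʳ 0# ⟩
    0#                                 ∎

  binomialSeries-S² : ∀ α → α ≈ - num 3 → ∀ m → binomialSeries α (suc (suc (suc m))) ≈ 0#
  binomialSeries-S² α α≈ m = begin
    binomialSeries α (3 ℕ.+ m)               ≈⟨ binomialSeries-negative 2 α α≈ (3 ℕ.+ m) ⟩
    (S 𝕊.* (S 𝕊.* 𝕊.1#)) (3 ℕ.+ m)         ≈⟨ S-suc (S 𝕊.* 𝕊.1#) (2 ℕ.+ m) ⟩
    (S 𝕊.* 𝕊.1#) (3 ℕ.+ m) - (S 𝕊.* 𝕊.1#) (2 ℕ.+ m)
      ≈⟨ +-cong (𝕊.*-identityʳ S (3 ℕ.+ m)) (-‿cong (𝕊.*-identityʳ S (2 ℕ.+ m))) ⟩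
    (0# - 0#) - (0# - 0#)                    ≈⟨ -‿inverseʳ (0# - 0#) ⟩
    0#                                       ∎

-- A and A / y share their operations but not their equality, so notions defined
-- by recursion over the whole structure agree only pointwise.
module _ (M : RawMonoid 0ℓ 0ℓ) (_∼_ : Rel (RawMonoid.Carrier M) 0ℓ) where
  private
    M′ : RawMonoid 0ℓ 0ℓ
    M′ = record { RawMonoid M ; _≈_ = _∼_ }
    module D  = RawMonoidDefinitions M
    module D′ = RawMonoidDefinitions M′

  sum-≈-irrelevant : ∀ {n} (f : Fin n → RawMonoid.Carrier M) → D.sum f ≡ D′.sum f
  sum-≈-irrelevant {zero}  f = ≡.refl
  sum-≈-irrelevant {suc n} f = ≡.cong (RawMonoid._∙_ M (f zero)) (sum-≈-irrelevant (f ∘ suc))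

module QuotientTerms (A : ℚ-Algebra) (y : ℚ-Algebra.Carrier A) where
  open ℚ-Algebra A using (Carrier)
  private
    module A = ℚ-Algebra A
    module Q = ℚ-Algebra (quotientAlgebra A y)
    module SA = BinomialSeries A
    module SQ = BinomialSeries (quotientAlgebra A y)
    module FA = FallingFactorial A
    module FQ = FallingFactorial (quotientAlgebra A y)

  ⊛-agree : ∀ {f f′ g g′ : ℕ → Carrier} → (∀ m → f m ≡ f′ m) → (∀ m → g m ≡ g′ m) →
            ∀ m → (f SA.𝕊.* g) m ≡ (f′ SQ.𝕊.* g′) m
  ⊛-agree p q zero    = ≡.cong₂ A._*_ (p 0) (q 0)
  ⊛-agree p q (suc m) = ≡.cong₂ A._+_ (≡.cong₂ A._*_ (p 0) (q (suc m))) (⊛-agree (λ k → p (suc k)) q m)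

  u-agree : ∀ m → SA.u m ≡ SQ.u m
  u-agree = ⊛-agree t-agree (⊛-agree
      (λ { zero → ≡.refl ; (suc m) → ≡.cong (A.0# A.+_) (t-agree (suc m)) }) λ _ → ≡.refl)
    where
    t-agree : ∀ m → SA.t m ≡ SQ.t m
    t-agree zero          = ≡.refl
    t-agree (suc zero)    = ≡.refl
    t-agree (suc (suc m)) = ≡.refl

  u^-agree : ∀ l m → (SA.u SA.𝕊.^ l) m ≡ (SQ.u SQ.𝕊.^ l) m
  u^-agree zero    zero    = ≡.refl
  u^-agree zero    (suc m) = ≡.refl
  u^-agree (suc l) m       = ⊛-agree u-agree (u^-agree l) m

  binomialSeries-agree : ∀ α m → SA.binomialSeries α m ≡ SQ.binomialSeries α m
  binomialSeries-agree α m = ≡.cong (A.ι (factorialRatio 0 m) A.*_)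
    -- A product is the `sum` of the multiplicative monoid.
    (sum-≈-irrelevant (RawRing.*-rawMonoid A.rawRing) Q._≈_ {m} λ k → α A.+ A.num m A.- A.num (toℕ k))

-- x = - root s p makes rootPoly (s - p) p (u) applied to g vanish in every
-- column, so row s, replaced by that combination, is divisible by x + root s p.
-- The factor x + 3p + 1 + l of the product formula is the one with s = p + l.
root : ℕ → ℕ → ℕ
root s p = suc (s ℕ.+ (p ℕ.+ p))

progression : ℕ → ℕ → List ℕ
progression s zero    = []
progression s (suc m) = root s m ∷ progression s m

-- Row 0 vanishes in addition at x = - 2 and x = - 3, where g is S and S².
rowRoots : ℕ → List ℕ
rowRoots zero    = 2 ∷ 3 ∷ progression 0 1
rowRoots (suc s) = progression (suc s) (suc (suc s))

allRoots : ℕ → List ℕ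
allRoots zero    = []
allRoots (suc n) = rowRoots n ++ allRoots n

root-injective : ∀ s {p q} → root s p ≡ root s q → p ≡ q
root-injective s {p} {q} h = double (ℕₚ.+-cancelˡ-≡ s _ _ (ℕₚ.suc-injective h))
  where
  double : ∀ {p q} → p ℕ.+ p ≡ q ℕ.+ q → p ≡ q
  double {zero}  {zero}  _ = ≡.refl
  double {suc p} {suc q} h = ≡.cong suc (double (ℕₚ.suc-injective (ℕₚ.suc-injective
    (≡.trans (≡.cong suc (≡.sym (ℕₚ.+-suc p p))) (≡.trans h (≡.cong suc (ℕₚ.+-suc q q)))))))

-- For a given s the root determines p, so a row meets k at most once, and a single polynomial in u
-- accounts for its whole share of the multiplicity.
occurrences-progression : ∀ k s m → occurrences k (progression s m) ≡ 0 ⊎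
  (occurrences k (progression s m) ≡ 1 × ∃ λ p → p < m × k ≡ root s p)
occurrences-progression k s zero    = inj₁ ≡.refl
occurrences-progression k s (suc m) with k ℕₚ.≟ root s m | occurrences-progression k s m
... | yes k≡ | inj₁ o≡0                 = inj₂ (≡.cong suc o≡0 , m , ℕₚ.≤-refl , k≡)
... | yes k≡ | inj₂ (_ , p , p<m , k≡′) =
  contradiction (root-injective s (≡.trans (≡.sym k≡′) k≡)) (ℕₚ.<⇒≢ p<m)
... | no _   | inj₁ o≡0                  = inj₁ o≡0
... | no _   | inj₂ (o≡1 , p , p<m , k≡) = inj₂ (o≡1 , p , ℕₚ.m≤n⇒m≤1+n p<m , k≡)

Leading-x+nat : ∀ k → Leading 1 1ℚ (x P.+ nat k)
Leading-x+nat k = Leading-x+ (+ k / 1)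

Leading-rootPoly : ∀ a p → Leading (a ℕ.+ p) 1ℚ (rootPoly a p)
Leading-rootPoly a p = Leading-* {p = (x P.+ nat 3) P.^ a} {(x P.+ nat 1) P.^ p}
  (Leading-^ {x P.+ nat 3} (Leading-x+nat 3) a) (Leading-^ {x P.+ nat 1} (Leading-x+nat 1) p)

chebLeading : ℕ → ℚ
chebLeading zero    = + 2 / 1
chebLeading (suc _) = 1ℚ

Leading-cheb : ∀ i → Leading i (chebLeading i) (cheb i)
Leading-cheb zero          = Leading-const _
Leading-cheb (suc zero)    = Leading-x+nat 5
Leading-cheb (suc (suc i)) =
  Leading-+ {p = (x P.+ nat 5) P.* cheb (suc i)} {P.- (nat 4 P.* cheb i)}
    (Leading-* {p = x P.+ nat 5} {cheb (suc i)} (Leading-x+nat 5) (Leading-cheb (suc i)))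
    (Leading-neg {p = nat 4 P.* cheb i} (Leading-raise (Leading-raise
      (Leading-* {p = nat 4} {cheb i} (Leading-const _) (Leading-cheb i)))))

column : ℕ → ℕ
column j = 2 ℕ.* j ℕ.+ 3

column-odd : ∀ j → column j ≡ suc (suc j ℕ.* 2)
column-odd = solve 1 (λ j → con 2 :* j :+ con 3 := con 1 :+ (con 2 :+ j :* con 2)) ≡.refl
  where open +-*-Solver

-- Row operations and the divisibility of the determinant

module DeterminantExpansion (A : ℚ-Algebra) where
  open ℚ-Algebra A
  open DeterminantProperties ring
  open Determinant rawRing using (det)

  -- The coefficients of polynomials of degree at most i form a lower triangular matrix with
  -- diagonal d. This serves the passage from the matrix to N, the replacements at each k, and the
  -- change of nodes in the determinant of leading coefficients.
  det-combination : ∀ n (p : Fin n → Polynomial) (d : Fin n → ℚ) (a : ℕ → Fin n → Carrier) →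
    (∀ i → Leading (toℕ i) (d i) (p i)) →
    det (λ i j → sum {n} λ l → ι (coeff (p i) (toℕ l)) * a (toℕ l) j) ≈
    product (λ i → ι (d i)) * det (λ i j → a (toℕ i) j)
  det-combination n p d a lead = trans
    (det-lowerTriangular-* (λ i l → ι (coeff (p i) (toℕ l))) (λ l j → a (toℕ l) j)
      λ i l i<l → trans (reflexive (≡.cong ι (above (lead i) (toℕ l) i<l))) ι-0)
    (*-congʳ (FallingFactorial.product-cong A {n} λ i → reflexive (≡.cong ι (top (lead i)))))

module Rows (A : ℚ-Algebra) (x : ℚ-Algebra.Carrier A)
  (lin-cancel : LinearCancellation A x) where
  open ℚ-Algebra A
  open LinearFactors A x lin-cancel
  open FallingFactorial A
  open BinomialSeries A
  open DeterminantProperties ring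
  open DeterminantExpansion A
  open Determinant rawRing using (det)
  open SetoidReasoning setoid

  -- The matrix N.
  row : ℕ → ℕ → Carrier
  row l j = (u 𝕊.^ l 𝕊.* binomialSeries x) (column j)

  combination : ℕ → Polynomial → ℕ → Carrier
  combination n p j = sum {n} λ l → ι (coeff p (toℕ l)) * row (toℕ l) j

  module _ (k : ℕ) where
    private
      module Q = ℚ-Algebra (quotientAlgebra A (lin k))
      module SQ = BinomialSeries (quotientAlgebra A (lin k))
    open QuotientTerms A (lin k)

    x∼-k : x Q.≈ Q.- Q.num k
    x∼-k = 1# , trans (solve 2 (λ x k → x := :- k :+ (x :+ k) :* con 1ℚ) refl x (num k)) (+-congˡ (*-congˡ ι-1))
      where open Solver

    combination-agree : ∀ n p j → combination n p j Q.≈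
      Q.sum {n} (λ l → Q.ι (coeff p (toℕ l)) Q.* (SQ.u SQ.𝕊.^ toℕ l SQ.𝕊.* SQ.binomialSeries x) (column j))
    combination-agree n p j = Q.trans
      (Q.reflexive (sum-≈-irrelevant (RawRing.+-rawMonoid rawRing) Q._≈_ {n} λ l → ι (coeff p (toℕ l)) * row (toℕ l) j))
      (Q.sum-cong-≋ {n} λ l → Q.reflexive (≡.cong (ι (coeff p (toℕ l)) *_)
        (⊛-agree (u^-agree (toℕ l)) (binomialSeries-agree x) (column j))))

    -- A zero of the quotient is a multiple of x + k in the algebra itself. The combination is
    -- formed in the algebra, so it is first matched with the sums and series of the quotient, where
    -- evenness is available.
    combination-divisible : ∀ n p {d c} → Leading d c p → d < n →
      (∀ j → (SQ.eval p SQ.𝕊.* SQ.binomialSeries x) (column j) Q.≈ 0#) →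
      ∀ j → ∃ λ q → combination n p j ≈ lin k * q
    combination-divisible n p lead d<n h j = proj₁ vanishes , trans (proj₂ vanishes) (+-identityˡ _)
      where
      vanishes : combination n p j Q.≈ 0#
      vanishes = Q.trans (combination-agree n p j) (Q.trans
        (Q.sym (SQ.eval-expand-* n p (SQ.binomialSeries x) (column j) λ m n≤m → above lead m (ℕₚ.≤-trans d<n n≤m)))
        (h j))

    -- What the argument requires of row s at a fixed k: a monic polynomial of degree s leaves the
    -- determinant unchanged, and the common factor of the entries can be taken out of the row. Only
    -- e = 0 and e = 1 occur.
    RowPolynomial : ℕ → ℕ → ℕ → Set
    RowPolynomial n s e = ∃ λ p → Leading s 1ℚ p × ∀ j → ∃ λ q → combination n p j ≈ lin k ^ e * q

    trivialRow : ∀ n s → RowPolynomial n s 0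
    trivialRow n s = Defs.x P.^ s , Leading-^ {Defs.x} Leading-x s ,
      λ j → combination n (Defs.x P.^ s) j , sym (*-identityˡ _)

    divisibleRow : ∀ n p s → Leading s 1ℚ p → s < n →
      (∀ j → (SQ.eval p SQ.𝕊.* SQ.binomialSeries x) (column j) Q.≈ 0#) → RowPolynomial n s 1
    divisibleRow n p s lead s<n h = p , lead , λ j →
      proj₁ (combination-divisible n p lead s<n h j) ,
      trans (proj₂ (combination-divisible n p lead s<n h j)) (*-congʳ (sym (*-identityʳ _)))

    rootRow : ∀ n s p → p ≤ s → s < n → k ≡ root s p → RowPolynomial n s 1
    rootRow n s p p≤s s<n k≡ = divisibleRow n (rootPoly a p) s
      (≡.subst (λ d → Leading d 1ℚ (rootPoly a p)) a+p≡s (Leading-rootPoly a p)) s<n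
      λ j → Q.trans (Q.reflexive (≡.cong (SQ.eval (rootPoly a p) SQ.𝕊.* SQ.binomialSeries x) (column-odd j)))
        (SQ.Even-rootPoly a p x (Q.trans x∼-k (Q.-‿cong (Q.reflexive (≡.cong Q.num k≡′)))) (suc j))
      where
      a : ℕ
      a = s ℕ.∸ p

      a+p≡s : a ℕ.+ p ≡ s
      a+p≡s = ℕₚ.m∸n+n≡m p≤s

      k≡′ : k ≡ suc (a ℕ.+ (p ℕ.+ p ℕ.+ p))
      k≡′ = ≡.trans k≡ (≡.cong suc (≡.trans (≡.cong (ℕ._+ (p ℕ.+ p)) (≡.sym a+p≡s))
        (solve 2 (λ a p → a :+ p :+ (p :+ p) := a :+ (p :+ p :+ p)) ≡.refl a p)))
        where open +-*-Solver

    firstRow : ∀ n → 0 < n → (∀ m → SQ.binomialSeries x (3 ℕ.+ m) Q.≈ 0#) → RowPolynomial n 0 1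
    firstRow n 0<n h = divisibleRow n P.1# 0 (Leading-const 1ℚ) 0<n λ j → Q.trans
      (SQ.𝕊.*-congʳ {SQ.binomialSeries x} (SQ.𝕊.trans (SQ.eval-const 1ℚ) SQ.𝕊.ι-1) (column j)) (Q.trans
      (SQ.𝕊.*-identityˡ (SQ.binomialSeries x) (column j)) (Q.trans
      (Q.reflexive (≡.cong (SQ.binomialSeries x) (ℕₚ.+-comm (2 ℕ.* j) 3))) (h (2 ℕ.* j))))

  -- Row 0 is settled by cases on k, where its three roots come from different sources: parity at 1,
  -- the low degree of S and S² at 2 and 3. The later rows have parity alone.
  rowPolynomial : ∀ k n s → s < n → RowPolynomial k n s (occurrences k (rowRoots s))
  rowPolynomial 0 n zero 0<n = trivialRow 0 n 0
  rowPolynomial 1 n zero 0<n = rootRow 1 n 0 0 z≤n 0<n ≡.refl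
  rowPolynomial 2 n zero 0<n = firstRow 2 n 0<n λ m → Q.binomialSeries-S x (x∼-k 2) (suc m)
    where module Q = BinomialSeries (quotientAlgebra A (lin 2))
  rowPolynomial 3 n zero 0<n = firstRow 3 n 0<n (Q.binomialSeries-S² x (x∼-k 3))
    where module Q = BinomialSeries (quotientAlgebra A (lin 3))
  rowPolynomial (suc (suc (suc (suc k)))) n zero 0<n = trivialRow (4 ℕ.+ k) n 0
  rowPolynomial k n (suc s) s<n with occurrences-progression k (suc s) (suc (suc s))
  ... | inj₁ o≡0                  = ≡.subst (RowPolynomial k n (suc s)) (≡.sym o≡0) (trivialRow k n (suc s))
  ... | inj₂ (o≡1 , p , p<s , k≡) =
    ≡.subst (RowPolynomial k n (suc s)) (≡.sym o≡1) (rootRow k n (suc s) p (ℕₚ.≤-pred p<s) s<n k≡)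

  rowDet : ℕ → Carrier
  rowDet n = det {n} λ i j → row (toℕ i) (toℕ j)

  product-rowRoots : ∀ k n → product {n} (λ i → lin k ^ occurrences k (rowRoots (toℕ i))) ≈
                     lin k ^ occurrences k (allRoots n)
  product-rowRoots k zero    = refl
  product-rowRoots k (suc n) = begin
    product {suc n} (λ i → lin k ^ occurrences k (rowRoots (toℕ i)))
      ≈⟨ product-last n (λ i → lin k ^ occurrences k (rowRoots i)) ⟩
    product {n} (λ i → lin k ^ occurrences k (rowRoots (toℕ i))) * lin k ^ occurrences k (rowRoots n)
      ≈⟨ trans (*-congʳ (product-rowRoots k n)) (*-comm _ _) ⟩
    lin k ^ occurrences k (rowRoots n) * lin k ^ occurrences k (allRoots n)
      ≈⟨ Exp.^-homo-* commutativeSemiring (lin k) (occurrences k (rowRoots n)) (occurrences k (allRoots n)) ⟨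
    lin k ^ (occurrences k (rowRoots n) ℕ.+ occurrences k (allRoots n))
      ≡⟨ ≡.cong (lin k ^_) (occurrences-++ k (rowRoots n) (allRoots n)) ⟨
    lin k ^ occurrences k (allRoots (suc n)) ∎

  -- All rows are replaced simultaneously for this one k, and the factors taken out of the rows add
  -- up to the multiplicity of k among all roots.
  lin^-∣-rowDet : ∀ n k → ∃ λ c → rowDet n ≈ lin k ^ occurrences k (allRoots n) * c
  lin^-∣-rowDet n k = det quotient , (begin
    rowDet n
      ≈⟨ trans (*-congʳ (product-one n)) (*-identityˡ _) ⟨
    product {n} (λ _ → ι 1ℚ) * rowDet n
      ≈⟨ det-combination n (λ i → proj₁ (rows i)) (λ _ → 1ℚ) (λ l j → row l (toℕ j)) (λ i → proj₁ (proj₂ (rows i))) ⟨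
    det (λ i j → combination n (proj₁ (rows i)) (toℕ j))
      ≈⟨ det-cong {n} (λ i j → proj₂ (proj₂ (proj₂ (rows i)) (toℕ j))) ⟩
    det (λ i j → lin k ^ occurrences k (rowRoots (toℕ i)) * quotient i j)
      ≈⟨ det-scaleRows (λ (i : Fin n) → lin k ^ occurrences k (rowRoots (toℕ i))) quotient ⟩
    product {n} (λ i → lin k ^ occurrences k (rowRoots (toℕ i))) * det quotient
      ≈⟨ *-congʳ (product-rowRoots k n) ⟩
    lin k ^ occurrences k (allRoots n) * det quotient ∎)
    where
    rows : ∀ i → RowPolynomial k n (toℕ i) (occurrences k (rowRoots (toℕ i)))
    rows i = rowPolynomial k n (toℕ i) (toℕ<n i)

    quotient : Fin n → Fin n → Carrier
    quotient i j = proj₁ (proj₂ (proj₂ (rows i)) (toℕ j))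

  linProduct-∣-rowDet : ∀ n → ∃ λ c → rowDet n ≈ linProduct (allRoots n) * c
  linProduct-∣-rowDet n = linProduct-divides (allRoots n) (lin^-∣-rowDet n)

  -- Bracketed as in the theorem, so that over ℚ[x] the two matrices agree by unfolding.
  matrix : ℕ → ℕ → Carrier
  matrix i j = num 4 ^ i * gbinomial (x + num i + num (2 ℕ.* j) + num 3) (column j)
                         + gbinomial (x - num i + num (2 ℕ.* j) + num 3) (column j)

  matrix-combination : ∀ n i j → i < n → matrix i j ≈ combination n (cheb i) j
  matrix-combination n i j i<n = begin
    matrix i j
      ≈⟨ +-cong (*-congˡ (gbinomial-cong (column j) (shift (x + num i)))) (gbinomial-cong (column j) (shift (x - num i))) ⟩
    num 4 ^ i * binomialSeries (x + num i) (column j) + binomialSeries (x - num i) (column j)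
      ≈⟨ eval-cheb-* i x (column j) ⟨
    (eval (cheb i) 𝕊.* binomialSeries x) (column j)
      ≈⟨ eval-expand-* n (cheb i) (binomialSeries x) (column j)
           (λ m n≤m → above (Leading-cheb i) m (ℕₚ.≤-trans i<n n≤m)) ⟩
    combination n (cheb i) j ∎
    where
    shift : ∀ α → α + num (2 ℕ.* j) + num 3 ≈ α + num (column j)
    shift α = trans (+-assoc _ _ _) (+-congˡ (sym (num-+ (2 ℕ.* j) 3)))

  det-matrix : ∀ n → det {suc n} (λ i j → matrix (toℕ i) (toℕ j)) ≈ num 2 * rowDet (suc n)
  det-matrix n = begin
    det {suc n} (λ i j → matrix (toℕ i) (toℕ j))
      ≈⟨ det-cong {suc n} (λ i j → matrix-combination (suc n) (toℕ i) (toℕ j) (toℕ<n i)) ⟩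
    det {suc n} (λ i j → combination (suc n) (cheb (toℕ i)) (toℕ j))
      ≈⟨ det-combination (suc n) (λ i → cheb (toℕ i)) (λ i → chebLeading (toℕ i)) (λ l j → row l (toℕ j))
           (λ i → Leading-cheb (toℕ i)) ⟩
    product {suc n} (λ i → ι (chebLeading (toℕ i))) * rowDet (suc n)
      -- The only leading coefficient other than 1 is the 2 of `cheb zero`, present because the
      -- matrix is not empty.
      ≈⟨ *-congʳ (trans (*-congˡ (product-one n)) (*-identityʳ _)) ⟩
    num 2 * rowDet (suc n) ∎

-- Degrees in x of the rows and of the determinant

module _ (A : ℚ-Algebra) where
  open ℚ-Algebra A
  open BinomialSeries A
  open SetoidReasoning setoid

  u-* : ∀ f → u 𝕊.* f 𝕊.≈ t 𝕊.* ((𝕊.num 3 𝕊.+ t) 𝕊.* (σ 𝕊.* f))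
  u-* f = 𝕊.trans (𝕊.*-assoc t ((𝕊.num 3 𝕊.+ t) 𝕊.* σ) f)
    (𝕊.*-congˡ {t} (𝕊.*-assoc (𝕊.num 3 𝕊.+ t) σ f))

  scaled-row-suc : ∀ b i g m →
    b * (u 𝕊.* (λ k → b ^ i * (u 𝕊.^ i 𝕊.* g) k)) m ≈ b ^ suc i * (u 𝕊.^ suc i 𝕊.* g) m
  scaled-row-suc b i g m = begin
    b * (u 𝕊.* (λ k → b ^ i * (u 𝕊.^ i 𝕊.* g) k)) m
      ≈⟨ *-congˡ (𝕊.*-comm u (λ k → b ^ i * (u 𝕊.^ i 𝕊.* g) k) m) ⟩
    b * ((λ k → b ^ i * (u 𝕊.^ i 𝕊.* g) k) 𝕊.* u) m
      ≈⟨ *-congˡ (⊛-scale ring (b ^ i) (u 𝕊.^ i 𝕊.* g) u m) ⟩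
    b * (b ^ i * ((u 𝕊.^ i 𝕊.* g) 𝕊.* u) m)
      ≈⟨ *-assoc _ _ _ ⟨
    b ^ suc i * ((u 𝕊.^ i 𝕊.* g) 𝕊.* u) m
      ≈⟨ *-congˡ (trans (𝕊.*-comm (u 𝕊.^ i 𝕊.* g) u m) (sym (𝕊.*-assoc u (u 𝕊.^ i) g m))) ⟩
    b ^ suc i * (u 𝕊.^ suc i 𝕊.* g) m ∎

module _ where
  open ℚ-Algebra polynomialAlgebra
  open BinomialSeries polynomialAlgebra
  private module B = BinomialSeries polynomialAlgebra

  -- The allowed degree grows with the index, so t counts as one degree of x: a factor t contributes
  -- nothing to the top unless a factor x accompanies it.
  LeadingSeries : (ℕ → ℚ) → (ℕ → Polynomial) → Set
  LeadingSeries c f = ∀ m → Leading m (c m) (f m)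

  Leading-≡ : ∀ {d c c′ p} → c ≡ c′ → Leading d c p → Leading d c′ p
  Leading-≡ ≡.refl l = l

  Leading-1* : ∀ {d c} p → Leading d c p → Leading d c (1# * p)
  Leading-1* p = Leading-cong {p = p} {1# * p} (sym {1# * p} {p} (*-identityˡ p))

  -- Of σ = 1 + t + t² + ... only the constant term reaches the top degree.
  LeadingSeries-σ : ∀ {c} f → LeadingSeries c f → LeadingSeries c (σ 𝕊.* f)
  LeadingSeries-σ f l zero    = Leading-1* (f 0) (l 0)
  LeadingSeries-σ {c} f l (suc m) = Leading-≡ (ℚₚ.+-identityʳ (c (suc m)))
    (Leading-+ {p = 1# * f (suc m)} {(σ 𝕊.* f) m} (Leading-1* (f (suc m)) (l (suc m)))
      (Leading-raise (LeadingSeries-σ f l m)))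

  LeadingSeries-t : ∀ {c} f → LeadingSeries c f → LeadingSeries (λ _ → 0ℚ) (t 𝕊.* f)
  LeadingSeries-t f l zero    = Leading-cong {p = 0#} {(t 𝕊.* f) 0} (λ _ → ≡.refl) (Leading-0 0)
  LeadingSeries-t f l (suc m) = Leading-cong {p = f m} {(t 𝕊.* f) (suc m)}
    (sym {(t 𝕊.* f) (suc m)} {f m} (t-suc f m)) (Leading-raise (l m))

  LeadingSeries-3+t : ∀ {c} f → LeadingSeries c f →
                      LeadingSeries (λ m → (+ 3 / 1) ℚ.* c m) ((𝕊.num 3 𝕊.+ t) 𝕊.* f)
  LeadingSeries-3+t {c} f l m = Leading-cong {p = nat 3 * f m + (t 𝕊.* f) m} {((𝕊.num 3 𝕊.+ t) 𝕊.* f) m}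
    (sym {((𝕊.num 3 𝕊.+ t) 𝕊.* f) m} {nat 3 * f m + (t 𝕊.* f) m}
      (trans {((𝕊.num 3 𝕊.+ t) 𝕊.* f) m} {(𝕊.num 3 𝕊.* f) m + (t 𝕊.* f) m} {nat 3 * f m + (t 𝕊.* f) m}
        (𝕊.distribʳ f (𝕊.num 3) t m)
        (+-congʳ {(t 𝕊.* f) m} {(𝕊.num 3 𝕊.* f) m} {nat 3 * f m} (constant-* (+ 3 / 1) f m))))
    (Leading-≡ (ℚₚ.+-identityʳ _) (Leading-+ {p = nat 3 * f m} {(t 𝕊.* f) m}
      (Leading-* {p = nat 3} {f m} (Leading-const (+ 3 / 1)) (l m)) (LeadingSeries-t f l m)))

  -- u = 3 t + O(t²), and only the term 3 t contributes to the top degree.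
  shift3 : (ℕ → ℚ) → ℕ → ℚ
  shift3 c zero    = 0ℚ
  shift3 c (suc m) = (+ 3 / 1) ℚ.* c m

  LeadingSeries-x*u : ∀ {c} f → LeadingSeries c f → LeadingSeries (shift3 c) (λ m → x * (B.u 𝕊.* f) m)
  LeadingSeries-x*u {c} f l m = Leading-cong {p = x * (t 𝕊.* h) m} {x * (B.u 𝕊.* f) m}
    (*-congˡ {x} {(t 𝕊.* h) m} {(B.u 𝕊.* f) m}
      (sym {(B.u 𝕊.* f) m} {(t 𝕊.* h) m} (u-* polynomialAlgebra f m))) (x*t m)
    where
    h : ℕ → Polynomial
    h = (𝕊.num 3 𝕊.+ t) 𝕊.* (σ 𝕊.* f)

    x*t : ∀ m → Leading m (shift3 c m) (x * (t 𝕊.* h) m)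
    x*t zero    = Leading-cong {p = 0#} {x * (t 𝕊.* h) 0}
      (sym {x * (t 𝕊.* h) 0} {0#} (zeroʳ x)) (Leading-0 0)
    x*t (suc m) = Leading-≡ (ℚₚ.*-identityˡ _) (Leading-cong {p = x * h m} {x * (t 𝕊.* h) (suc m)}
      (*-congˡ {x} {h m} {(t 𝕊.* h) (suc m)} (sym {(t 𝕊.* h) (suc m)} {h m} (t-suc h m)))
      (Leading-* {p = x} {h m} Leading-x (LeadingSeries-3+t (σ 𝕊.* f) (LeadingSeries-σ f l) m)))

  -- The value 3ⁱ / (m - i)!, with 0 for m < i, in the recursive form that multiplication by x u
  -- produces.
  rowLeading : ℕ → ℕ → ℚ
  rowLeading zero    = factorialRatio 0
  rowLeading (suc i) = shift3 (rowLeading i)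

  LeadingSeries-row : ∀ i → LeadingSeries (rowLeading i) (λ m → x ^ i * (B.u 𝕊.^ i 𝕊.* binomialSeries x) m)
  LeadingSeries-row zero m = Leading-1* ((𝕊.1# 𝕊.* g) m) (Leading-cong {p = g m} {(𝕊.1# 𝕊.* g) m}
    (sym {(𝕊.1# 𝕊.* g) m} {g m} (𝕊.*-identityˡ g m))
    (Leading-≡ (ℚₚ.*-identityʳ _) (Leading-* {p = const (factorialRatio 0 m)} {product factor}
      (Leading-const (factorialRatio 0 m)) (Leading-product factor λ k →
        Leading-+ {p = x + nat m} {q = - nat (toℕ k)} (Leading-x+nat m)
          (Leading-raise (Leading-neg {p = nat (toℕ k)} (Leading-const (+ toℕ k / 1))))))))
    where
    g : ℕ → Polynomial
    g = binomialSeries x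
    factor : Fin m → Polynomial
    factor k = x + nat m - nat (toℕ k)
  LeadingSeries-row (suc i) m = Leading-cong
    {p = x * (B.u 𝕊.* (λ k → x ^ i * (B.u 𝕊.^ i 𝕊.* binomialSeries x) k)) m}
    {x ^ suc i * (B.u 𝕊.^ suc i 𝕊.* binomialSeries x) m}
    (scaled-row-suc polynomialAlgebra x i (binomialSeries x) m)
    (LeadingSeries-x*u (λ k → x ^ i * (B.u 𝕊.^ i 𝕊.* binomialSeries x) k) (LeadingSeries-row i) m)

  private
    module Dₚ = Determinant rawRing
    module Dℚ = Determinant ℚ-rawRing
    module Qₐ = ℚ-Algebra ℚ-algebra

  Leading-sum : ∀ {n d} (c : Fin n → ℚ) (p : Fin n → Polynomial) → (∀ i → Leading d (c i) (p i)) →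
                Leading d (Qₐ.sum c) (sum p)
  Leading-sum {zero}  {d} c p l = Leading-0 d
  Leading-sum {suc n} c p l = Leading-+ {p = p zero} {sum (p ∘ suc)} (l zero) (Leading-sum (c ∘ suc) (p ∘ suc) (l ∘ suc))

  Leading-[-1]^ : ∀ n → Leading 0 ((ℚ.- 1ℚ) Qₐ.^ n) ((- 1#) ^ n)
  Leading-[-1]^ zero    = Leading-const 1ℚ
  Leading-[-1]^ (suc n) = Leading-* {p = - 1#} {(- 1#) ^ n} (Leading-const (ℚ.- 1ℚ)) (Leading-[-1]^ n)

  -- Each term of the expansion takes one entry from every column, so the column weights add up. The
  -- bound of an entry must depend on its column alone.
  Leading-det : ∀ {n} (w : Fin n → ℕ) (c : Fin n → Fin n → ℚ) (p : Fin n → Fin n → Polynomial) →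
    (∀ i j → Leading (w j) (c i j) (p i j)) → Leading (sumℕ w) (Dℚ.det c) (Dₚ.det p)
  Leading-det {zero}  w c p l = Leading-const 1ℚ
  Leading-det {suc n} w c p l = Leading-sum cⱼ pⱼ λ j →
    ≡.subst (λ d → Leading d (cⱼ j) (pⱼ j)) (≡.sym (ℕ-sum.sum-remove {i = j} w))
      (Leading-* {p = (- 1#) ^ toℕ j} {p zero j * minor j} (Leading-[-1]^ (toℕ j))
        (Leading-* {p = p zero j} {minor j} (l zero j)
          (Leading-det (λ s → w (punchIn j s)) (λ r s → c (suc r) (punchIn j s)) (λ r s → p (suc r) (punchIn j s))
            λ r s → l (suc r) (punchIn j s))))
    where
    minor : Fin (suc n) → Polynomial
    minor j = Dₚ.det λ r s → p (suc r) (punchIn j s)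

    cⱼ : Fin (suc n) → ℚ
    cⱼ j = (ℚ.- 1ℚ) Qₐ.^ toℕ j ℚ.* (c zero j ℚ.* Dℚ.det λ r s → c (suc r) (punchIn j s))

    pⱼ : Fin (suc n) → Polynomial
    pⱼ j = (- 1#) ^ toℕ j * (p zero j * minor j)

-- The determinant of the leading coefficients

module LeadingCoefficient where
  open ℚ-Algebra ℚ-algebra
  open FallingFactorial ℚ-algebra
  open DeterminantProperties ring
  open DeterminantExpansion ℚ-algebra
  open Determinant rawRing using (det)
  open ≡.≡-Reasoning

  -- The Newton basis polynomial of degree i at the nodes r; for r = `id` it is the falling
  -- factorial.
  newton : (ℕ → ℕ) → ℕ → ℚ → ℚ
  newton r i z = product {i} λ l → z - num (r (toℕ l))

  newtonPoly : (ℕ → ℕ) → ℕ → Polynomial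
  newtonPoly r i = P.product {i} λ l → x P.- nat (r (toℕ l))

  Leading-newtonPoly : ∀ r i → Leading i 1ℚ (newtonPoly r i)
  Leading-newtonPoly r i = Leading-product (λ (l : Fin i) → x P.- nat (r (toℕ l))) λ l →
    Leading-+ {p = x} {q = P.- nat (r (toℕ l))} Leading-x
      (Leading-raise (Leading-neg {p = nat (r (toℕ l))} (Leading-const (+ r (toℕ l) / 1))))

  newton-expand : ∀ r n i z f → i < n →
    newton r i z * f ≡ sum {n} (λ l → coeff (newtonPoly r i) (toℕ l) * (z ^ toℕ l * f))
  newton-expand r n i z f i<n = begin
    newton r i z * f
      ≡⟨ ≡.cong (_* f) (≡.sym evaluate) ⟩
    eval (newtonPoly r i) * f
      ≡⟨ ≡.cong (_* f) (eval-expand n (newtonPoly r i) λ k n≤k → above (Leading-newtonPoly r i) k (ℕₚ.≤-trans i<n n≤k)) ⟩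
    sum {n} (λ l → coeff (newtonPoly r i) (toℕ l) * z ^ toℕ l) * f
      ≡⟨ *-distribʳ-sum f (λ (l : Fin n) → coeff (newtonPoly r i) (toℕ l) * z ^ toℕ l) ⟩
    sum {n} (λ l → coeff (newtonPoly r i) (toℕ l) * z ^ toℕ l * f)
      ≡⟨ sum-cong-≋ {n} (λ l → ℚₚ.*-assoc (coeff (newtonPoly r i) (toℕ l)) (z ^ toℕ l) f) ⟩
    sum {n} (λ l → coeff (newtonPoly r i) (toℕ l) * (z ^ toℕ l * f)) ∎
    where
    open Evaluation ℚ-algebra z
    evaluate : eval (newtonPoly r i) ≡ newton r i z
    evaluate = ≡.trans (eval-product (λ (l : Fin i) → x P.- nat (r (toℕ l)))) (product-cong {i} λ l →
      ≡.trans (eval-+ x (P.- nat (r (toℕ l)))) (≡.cong₂ _+_ eval-x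
        (≡.trans (eval-neg (nat (r (toℕ l)))) (≡.cong -_ (eval-const (+ r (toℕ l) / 1))))))

  -- Independence of the nodes r lets the nodes be chosen so that the matrix is triangular.
  det-newton : ∀ r n (z f : Fin n → ℚ) →
    det (λ i j → newton r (toℕ i) (z j) * f j) ≡ det (λ i j → z j ^ toℕ i * f j)
  det-newton r n z f = begin
    det (λ i j → newton r (toℕ i) (z j) * f j)
      ≡⟨ det-cong {n} (λ i j → newton-expand r n (toℕ i) (z j) (f j) (toℕ<n i)) ⟩
    det (λ i j → sum {n} λ l → coeff (newtonPoly r (toℕ i)) (toℕ l) * (z j ^ toℕ l * f j))
      ≡⟨ det-combination n (λ i → newtonPoly r (toℕ i)) (λ _ → 1ℚ) (λ l j → z j ^ l * f j)
           (λ i → Leading-newtonPoly r (toℕ i)) ⟩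
    product {n} (λ _ → 1ℚ) * det (λ i j → z j ^ toℕ i * f j)
      ≡⟨ ≡.trans (≡.cong (_* det λ i j → z j ^ toℕ i * f j) (product-one n)) (ℚₚ.*-identityˡ _) ⟩
    det (λ i j → z j ^ toℕ i * f j) ∎

  three : ℚ
  three = + 3 / 1

  -- Writing 1 / (m - i)! as a falling factorial over m! exhibits a polynomial of degree i in m
  -- times a factor independent of i. The case m < i is included, since the falling factorial then
  -- contains the factor 0.
  rowLeading-falling : ∀ i m → rowLeading i m ≡ three ^ i * (falling (num m) i * factorialRatio 0 m)
  rowLeading-falling zero    m = ≡.sym (≡.trans (ℚₚ.*-identityˡ _) (ℚₚ.*-identityˡ _))
  rowLeading-falling (suc i) zero = ≡.sym (begin
    three ^ suc i * (0ℚ * product {i} (λ l → 0ℚ - num (suc (toℕ l))) * 1ℚ)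
      ≡⟨ ≡.cong (λ z → three ^ suc i * (z * 1ℚ)) (ℚₚ.*-zeroˡ (product {i} λ l → 0ℚ - num (suc (toℕ l)))) ⟩
    three ^ suc i * 0ℚ ≡⟨ ℚₚ.*-zeroʳ (three ^ suc i) ⟩
    0ℚ ∎)
  rowLeading-falling (suc i) (suc m) = begin
    three * rowLeading i m
      ≡⟨ ≡.cong (three *_) (rowLeading-falling i m) ⟩
    three * (three ^ i * (falling (num m) i * factorialRatio 0 m))
      ≡⟨ ≡.cong (λ r → three * (three ^ i * (falling (num m) i * r))) (factorialRatio-suc m) ⟨
    three * (three ^ i * (falling (num m) i * (factorialRatio 0 (suc m) * num (suc m))))
      ≡⟨ solve 5 (λ h p f r k → h :* (p :* (f :* (r :* k))) := h :* p :* (k :* f :* r)) ≡.refl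
           three (three ^ i) (falling (num m) i) (factorialRatio 0 (suc m)) (num (suc m)) ⟩
    three ^ suc i * (num (suc m) * falling (num m) i * factorialRatio 0 (suc m))
      ≡⟨ ≡.cong (λ f → three ^ suc i * (f * factorialRatio 0 (suc m))) first ⟨
    three ^ suc i * (falling (num (suc m)) (suc i) * factorialRatio 0 (suc m)) ∎
    where
    open Solver
    first : falling (num (suc m)) (suc i) ≡ num (suc m) * falling (num m) i
    first = ≡.trans (falling-cong (suc i) (num-suc m))
      (≡.trans (falling-first (num m) i) (≡.cong (_* falling (num m) i) (≡.sym (num-suc m))))

  product-zero : ∀ n (f : ℕ → ℚ) k → k < n → f k ≡ 0ℚ → product {n} (f ∘ toℕ) ≡ 0ℚ
  product-zero (suc n) f zero    _         f0≡0 =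
    ≡.trans (≡.cong (_* product {n} (λ i → f (suc (toℕ i)))) f0≡0) (ℚₚ.*-zeroˡ (product {n} λ i → f (suc (toℕ i))))
  product-zero (suc n) f (suc k) (s≤s k<n) fk≡0 =
    ≡.trans (≡.cong (f 0 *_) (product-zero n (f ∘ suc) k k<n fk≡0)) (ℚₚ.*-zeroʳ (f 0))

  column-suc : ∀ j → num (column (suc j)) ≡ num (column j) + num 2
  column-suc j = ≡.trans (≡.cong num (solve 1 (λ j → con 2 :* (con 1 :+ j) :+ con 3 := con 2 :* j :+ con 3 :+ con 2) ≡.refl j))
    (num-+ (column j) 2)
    where open +-*-Solver

  -- The nodes 2j + 3 have spacing 2, so the differences are 2 i, 2 (i - 1), ..., 2. The recursion
  -- splits off the largest one and shifts the remaining nodes down by one step.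
  newton-diagonal : ∀ i → newton column i (num (column i)) ≡ num 2 ^ i * num (i !)
  newton-diagonal zero    = ≡.refl
  newton-diagonal (suc i) = begin
    (num (column (suc i)) - num 3) * product {i} (λ l → num (column (suc i)) - num (column (suc (toℕ l))))
      ≡⟨ ≡.cong₂ _*_ head (product-cong {i} λ l → ≡.trans
           (≡.cong₂ _-_ (column-suc i) (column-suc (toℕ l)))
           (solve 3 (λ a b c → a :+ c :- (b :+ c) := a :- b) ≡.refl (num (column i)) (num (column (toℕ l))) (num 2))) ⟩
    num 2 * num (suc i) * newton column i (num (column i))
      ≡⟨ ≡.cong (num 2 * num (suc i) *_) (newton-diagonal i) ⟩
    num 2 * num (suc i) * (num 2 ^ i * num (i !))
      ≡⟨ solve 4 (λ a b c d → a :* b :* (c :* d) := a :* c :* (b :* d)) ≡.refl (num 2) (num (suc i)) (num 2 ^ i) (num (i !)) ⟩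
    num 2 ^ suc i * (num (suc i) * num (i !))
      ≡⟨ ≡.cong (num 2 ^ suc i *_) (fromℕ-* (suc i) (i !)) ⟨
    num 2 ^ suc i * num (suc i !) ∎
    where
    open Solver
    head : num (column (suc i)) - num 3 ≡ num 2 * num (suc i)
    head = ≡.trans (≡.cong (_- num 3) (≡.trans (num-+ (2 ℕ.* suc i) 3) (≡.cong (_+ num 3) (fromℕ-* 2 (suc i)))))
      (solve 3 (λ a b c → a :* b :+ c :- c := a :* b) ≡.refl (num 2) (num (suc i)) (num 3))

  factorialRatio-split : ∀ i m → factorialRatio i m ≡ num (i !) * factorialRatio 0 m
  factorialRatio-split i m = begin
    factorialRatio i m                                      ≡⟨ ℚₚ.*-identityʳ _ ⟨
    factorialRatio i m * 1ℚ                                 ≡⟨ ≡.cong (factorialRatio i m *_) (factorialRatio-! 0 m) ⟨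
    factorialRatio i m * (factorialRatio 0 m * num (m !))   ≡⟨ solve 3 (λ a b c → a :* (b :* c) := a :* c :* b) ≡.refl
                                                                 (factorialRatio i m) (factorialRatio 0 m) (num (m !)) ⟩
    factorialRatio i m * num (m !) * factorialRatio 0 m     ≡⟨ ≡.cong (_* factorialRatio 0 m) (factorialRatio-! i m) ⟩
    num (i !) * factorialRatio 0 m                          ∎
    where open Solver

  -- In 6 = 3 · 2 the 3 comes from u = 3 t + O(t²) and the 2 from the spacing of the nodes.
  leadingFactor : ℕ → ℚ
  leadingFactor i = num 6 ^ i * factorialRatio i (column i)

  det-rowLeading : ∀ n → det {n} (λ i j → rowLeading (toℕ i) (column (toℕ j))) ≡ product {n} (leadingFactor ∘ toℕ)
  det-rowLeading n = begin
    det {n} (λ i j → rowLeading (toℕ i) (column (toℕ j)))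
      ≡⟨ det-cong {n} (λ i j → rowLeading-falling (toℕ i) (column (toℕ j))) ⟩
    det {n} (λ i j → three ^ toℕ i * (newton id (toℕ i) (z j) * f j))
      ≡⟨ det-scaleRows {n} (λ i → three ^ toℕ i) (λ i j → newton id (toℕ i) (z j) * f j) ⟩
    threes * det {n} (λ i j → newton id (toℕ i) (z j) * f j)
      -- Falling factorials are exchanged for Newton polynomials whose nodes are the column indices
      -- themselves, so the entries with j < i vanish.
      ≡⟨ ≡.cong (threes *_) (≡.trans (det-newton id n z f) (≡.sym (det-newton column n z f))) ⟩
    threes * det {n} (λ i j → newton column (toℕ i) (z j) * f j)
      ≡⟨ ≡.cong (threes *_) (det-upperTriangular {n} (λ i j → newton column (toℕ i) (z j) * f j) λ i j j<i →
           ≡.trans (≡.cong (_* f j) (product-zero (toℕ i) (λ l → z j - num (column l)) (toℕ j) j<i (ℚₚ.+-inverseʳ (z j))))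
             (ℚₚ.*-zeroˡ (f j))) ⟩
    threes * product {n} (λ i → newton column (toℕ i) (z i) * f i)
      ≡⟨ product-* {n} (λ i → three ^ toℕ i) (λ i → newton column (toℕ i) (z i) * f i) ⟨
    product {n} (λ i → three ^ toℕ i * (newton column (toℕ i) (z i) * f i))
      ≡⟨ product-cong {n} (λ i → diagonal (toℕ i)) ⟩
    product {n} (leadingFactor ∘ toℕ) ∎
    where
    z f : Fin n → ℚ
    z j = num (column (toℕ j))
    f j = factorialRatio 0 (column (toℕ j))

    threes : ℚ
    threes = product {n} λ i → three ^ toℕ i

    diagonal : ∀ i → three ^ i * (newton column i (num (column i)) * factorialRatio 0 (column i)) ≡ leadingFactor i
    diagonal i = begin
      three ^ i * (newton column i (num (column i)) * factorialRatio 0 (column i))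
        ≡⟨ ≡.cong (λ d → three ^ i * (d * factorialRatio 0 (column i))) (newton-diagonal i) ⟩
      three ^ i * (num 2 ^ i * num (i !) * factorialRatio 0 (column i))
        ≡⟨ solve 4 (λ a b c d → a :* (b :* c :* d) := a :* b :* (c :* d)) ≡.refl
             (three ^ i) (num 2 ^ i) (num (i !)) (factorialRatio 0 (column i)) ⟩
      three ^ i * num 2 ^ i * (num (i !) * factorialRatio 0 (column i))
        ≡⟨ ≡.cong₂ _*_ (≡.sym (Exp.^-distrib-* commutativeSemiring three (num 2) i)) (≡.sym (factorialRatio-split i (column i))) ⟩
      leadingFactor i ∎
      where open Solver

  Invertible : ℚ → Set
  Invertible a = ∃ λ c → c * a ≡ 1ℚ

  Invertible-* : ∀ {a b} → Invertible a → Invertible b → Invertible (a * b)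
  Invertible-* {a} {b} (c , ca≡1) (d , db≡1) = c * d , ≡.trans
    (solve 4 (λ a b c d → c :* d :* (a :* b) := c :* a :* (d :* b)) ≡.refl a b c d)
    (≡.cong₂ _*_ ca≡1 db≡1)
    where open Solver

  Invertible-^ : ∀ {a} → Invertible a → ∀ n → Invertible (a ^ n)
  Invertible-^ i zero    = 1ℚ , ≡.refl
  Invertible-^ i (suc n) = Invertible-* i (Invertible-^ i n)

  Invertible-product : ∀ {n} (f : Fin n → ℚ) → (∀ i → Invertible (f i)) → Invertible (product f)
  Invertible-product {zero}  f i = 1ℚ , ≡.refl
  Invertible-product {suc n} f i = Invertible-* (i zero) (Invertible-product (f ∘ suc) (i ∘ suc))

  Invertible-leadingFactor : ∀ i → Invertible (leadingFactor i)
  Invertible-leadingFactor i = Invertible-* (Invertible-^ (+ 1 / 6 , ≡.refl) i)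
    (≡.subst Invertible (≡.sym (factorialRatio-split i (column i))) (Invertible-*
      (factorialRatio 0 i , factorialRatio-! 0 i)
      (num (column i !) , ≡.trans (ℚₚ.*-comm (num (column i !)) (factorialRatio 0 (column i))) (factorialRatio-! 0 (column i)))))

-- Degree count

triangle : ℕ → ℕ
triangle zero    = 0
triangle (suc n) = triangle n ℕ.+ n

length-progression : ∀ s m → length (progression s m) ≡ m
length-progression s zero    = ≡.refl
length-progression s (suc m) = ≡.cong suc (length-progression s m)

sumℕ-last : ∀ n (f : ℕ → ℕ) → sumℕ {suc n} (f ∘ toℕ) ≡ sumℕ {n} (f ∘ toℕ) ℕ.+ f n
sumℕ-last zero    f = ℕₚ.+-identityʳ (f 0)
sumℕ-last (suc n) f = ≡.trans (≡.cong (f 0 ℕ.+_) (sumℕ-last n (f ∘ suc))) (≡.sym (ℕₚ.+-assoc (f 0) _ (f (suc n))))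

-- Origin of 2n - 2: the columns give n² + 2n in all, the scaling of the rows by xⁱ takes n (n - 1)
-- / 2 of it, and the linear factors take n (n + 1) / 2 + 2.
degrees : ∀ n → 1 ≤ n →
          sumℕ {n} (column ∘ toℕ) ≡ triangle n ℕ.+ (length (allRoots n) ℕ.+ (2 ℕ.* n ℕ.∸ 2))
degrees (suc zero)    _ = ≡.refl
degrees (suc (suc n)) _ = begin
  sumℕ {suc (suc n)} (column ∘ toℕ)
    ≡⟨ sumℕ-last (suc n) column ⟩
  sumℕ {suc n} (column ∘ toℕ) ℕ.+ column (suc n)
    ≡⟨ ≡.cong (ℕ._+ column (suc n)) (degrees (suc n) (s≤s z≤n)) ⟩
  triangle (suc n) ℕ.+ (length (allRoots (suc n)) ℕ.+ (2 ℕ.* suc n ℕ.∸ 2)) ℕ.+ column (suc n)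
    ≡⟨ ≡.cong (λ d → triangle (suc n) ℕ.+ (length (allRoots (suc n)) ℕ.+ d) ℕ.+ column (suc n)) (double n) ⟩
  triangle (suc n) ℕ.+ (length (allRoots (suc n)) ℕ.+ 2 ℕ.* n) ℕ.+ column (suc n)
    ≡⟨ solve 3 (λ t l n → t :+ (l :+ con 2 :* n) :+ (con 2 :* (con 1 :+ n) :+ con 3)
         := t :+ (con 1 :+ n) :+ (con 2 :+ n :+ l :+ con 2 :* (con 1 :+ n))) ≡.refl
         (triangle (suc n)) (length (allRoots (suc n))) n ⟩
  triangle (suc (suc n)) ℕ.+ (suc (suc n) ℕ.+ length (allRoots (suc n)) ℕ.+ 2 ℕ.* suc n)
    ≡⟨ ≡.cong₂ (λ l d → triangle (suc (suc n)) ℕ.+ (l ℕ.+ d)) (≡.trans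
         (length-++ (rowRoots (suc n))) (≡.cong (ℕ._+ length (allRoots (suc n))) (length-progression (suc n) (suc (suc n)))))
         (double (suc n)) ⟨
  triangle (suc (suc n)) ℕ.+ (length (allRoots (suc (suc n))) ℕ.+ (2 ℕ.* suc (suc n) ℕ.∸ 2)) ∎
  where
  open ≡.≡-Reasoning
  open +-*-Solver

  double : ∀ n → 2 ℕ.* suc n ℕ.∸ 2 ≡ 2 ℕ.* n
  double n = ≡.trans (≡.cong (ℕ._∸ 2) (ℕₚ.*-suc 2 n)) (ℕₚ.m+n∸m≡n 2 (2 ℕ.* n))

suc-C-2 : ∀ n → suc n C 2 ≡ n C 2 ℕ.+ n
suc-C-2 n = ≡.trans (≡.sym (nCk+nC[k+1]≡[n+1]C[k+1] n 1)) (≡.trans (≡.cong (ℕ._+ n C 2) (nC1≡n n)) (ℕₚ.+-comm n (n C 2)))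

-- The product formula in the form of the theorem

module ProductForms (A : ℚ-Algebra) (x : ℚ-Algebra.Carrier A)
  (lin-cancel : LinearCancellation A x) where
  open ℚ-Algebra A
  open LinearFactors A x lin-cancel
  open FallingFactorial A
  open Rows A x lin-cancel
  open Determinant rawRing using (det)
  open SetoidReasoning setoid
  open Solver using (solve; _:=_; _:*_)
  open LeadingCoefficient using (leadingFactor)
  private module Qₐ = ℚ-Algebra ℚ-algebra

  product-^ : ∀ n → product {n} (λ i → x ^ toℕ i) ≈ x ^ triangle n
  product-^ zero    = refl
  product-^ (suc n) = trans (product-last n (x ^_))
    (trans (*-congʳ (product-^ n)) (sym (Exp.^-homo-* commutativeSemiring x (triangle n) n)))

  ι-^ : ∀ a n → ι (a Qₐ.^ n) ≈ ι a ^ n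
  ι-^ a zero    = ι-1
  ι-^ a (suc n) = trans (ι-* a (a Qₐ.^ n)) (*-congˡ (ι-^ a n))

  ι-product : ∀ {n} (f : Fin n → ℚ) → ι (Qₐ.product f) ≈ product (λ i → ι (f i))
  ι-product {zero}  f = ι-1
  ι-product {suc n} f = trans (ι-* (f zero) (Qₐ.product (f ∘ suc))) (*-congˡ (ι-product (f ∘ suc)))

  ι-leadingFactors : ∀ n → ι (Qₐ.product {n} (leadingFactor ∘ toℕ)) ≈
    num 6 ^ (n C 2) * product {n} (λ i → ι (factorialRatio (toℕ i) (2 ℕ.* toℕ i ℕ.+ 3)))
  ι-leadingFactors n = trans (ι-product {n} (leadingFactor ∘ toℕ)) (go n)
    where
    r : ℕ → Carrier
    r i = ι (factorialRatio i (2 ℕ.* i ℕ.+ 3))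

    go : ∀ n → product {n} (λ i → ι (leadingFactor (toℕ i))) ≈ num 6 ^ (n C 2) * product {n} (r ∘ toℕ)
    go zero    = sym (*-identityˡ 1#)
    go (suc n) = begin
      product {suc n} (λ i → ι (leadingFactor (toℕ i)))
        ≈⟨ product-last n (ι ∘ leadingFactor) ⟩
      product {n} (λ i → ι (leadingFactor (toℕ i))) * ι (leadingFactor n)
        ≈⟨ *-cong (go n) (trans (ι-* (Qₐ.num 6 Qₐ.^ n) (factorialRatio n (2 ℕ.* n ℕ.+ 3))) (*-congʳ (ι-^ (Qₐ.num 6) n))) ⟩
      num 6 ^ (n C 2) * product {n} (r ∘ toℕ) * (num 6 ^ n * r n)
        ≈⟨ solve 4 (λ a b c d → a :* b :* (c :* d) := a :* c :* (b :* d)) refl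
             (num 6 ^ (n C 2)) (product {n} (r ∘ toℕ)) (num 6 ^ n) (r n) ⟩
      num 6 ^ (n C 2) * num 6 ^ n * (product {n} (r ∘ toℕ) * r n)
        ≈⟨ *-cong (trans (reflexive (≡.cong (num 6 ^_) (suc-C-2 n))) (Exp.^-homo-* commutativeSemiring (num 6) (n C 2) n))
                  (product-last n r) ⟨
      num 6 ^ (suc n C 2) * product {suc n} (r ∘ toℕ) ∎

  pochhammers : ℕ → Carrier
  pochhammers n = product {n} λ i → product {n ℕ.∸ toℕ i} λ l → x + num (3 ℕ.* toℕ i) + num 1 + num (toℕ l)

  factor : ℕ → ℕ → Carrier
  factor i l = x + num (3 ℕ.* i) + num 1 + num l

  factor-root : ∀ s p → p ≤ s → factor p (s ℕ.∸ p) ≈ lin (root s p)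
  factor-root s p p≤s = trans (+-assoc _ _ _) (trans (+-assoc _ _ _) (+-congˡ (begin
    num (3 ℕ.* p) + (num 1 + num (s ℕ.∸ p))  ≈⟨ +-congˡ (num-+ 1 (s ℕ.∸ p)) ⟨
    num (3 ℕ.* p) + num (1 ℕ.+ (s ℕ.∸ p))     ≈⟨ num-+ (3 ℕ.* p) (1 ℕ.+ (s ℕ.∸ p)) ⟨
    num (3 ℕ.* p ℕ.+ (1 ℕ.+ (s ℕ.∸ p)))       ≡⟨ ≡.cong num (≡.trans
      (rearrange p (s ℕ.∸ p)) (≡.cong (λ m → suc (m ℕ.+ (p ℕ.+ p))) (ℕₚ.m∸n+n≡m p≤s))) ⟩
    num (root s p)                            ∎)))
    where
    rearrange : ∀ p d → 3 ℕ.* p ℕ.+ (1 ℕ.+ d) ≡ suc (d ℕ.+ p ℕ.+ (p ℕ.+ p))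
    rearrange = solveℕ 2 (λ p d → conℕ 3 ⊗ p ⊕ (conℕ 1 ⊕ d) ⊜ conℕ 1 ⊕ (d ⊕ p ⊕ (p ⊕ p))) ≡.refl
      where open +-*-Solver using () renaming (solve to solveℕ; con to conℕ; _:+_ to _⊕_; _:*_ to _⊗_; _:=_ to _⊜_)

  linProduct-progression : ∀ s m → m ≤ suc s →
    linProduct (progression s m) ≈ product {m} (λ p → factor (toℕ p) (s ℕ.∸ toℕ p))
  linProduct-progression s zero    m≤ = refl
  linProduct-progression s (suc m) (s≤s m≤s) = begin
    lin (root s m) * linProduct (progression s m)
      ≈⟨ *-cong (sym (factor-root s m m≤s)) (linProduct-progression s m (ℕₚ.m≤n⇒m≤1+n m≤s)) ⟩
    factor m (s ℕ.∸ m) * product {m} (λ p → factor (toℕ p) (s ℕ.∸ toℕ p))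
      ≈⟨ *-comm _ _ ⟩
    product {m} (λ p → factor (toℕ p) (s ℕ.∸ toℕ p)) * factor m (s ℕ.∸ m)
      ≈⟨ product-last m (λ p → factor p (s ℕ.∸ p)) ⟨
    product {suc m} (λ p → factor (toℕ p) (s ℕ.∸ toℕ p)) ∎

  -- The factors x + 3p + 1 + l with p + l = n are those of row n.
  pochhammers-suc : ∀ n → pochhammers (suc n) ≈ linProduct (progression n (suc n)) * pochhammers n
  pochhammers-suc n = begin
    pochhammers (suc n)
      ≈⟨ product-last n (λ i → product {suc n ℕ.∸ i} (factor i ∘ toℕ)) ⟩
    product {n} (λ i → product {suc n ℕ.∸ toℕ i} (factor (toℕ i) ∘ toℕ)) * product {suc n ℕ.∸ n} (factor n ∘ toℕ)
      -- Each block i gains the factor with l = n - i; the new block i = n has that factor alone,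
      -- since n - n = 0.
      ≈⟨ *-cong (product-cong {n} λ i → step (toℕ i) (ℕₚ.<⇒≤ (toℕ<n i))) (trans (step n ℕₚ.≤-refl)
           (trans (*-congʳ (reflexive (≡.cong (λ d → product {d} (factor n ∘ toℕ)) (ℕₚ.n∸n≡0 n)))) (*-identityˡ _))) ⟩
    product {n} (λ i → product {n ℕ.∸ toℕ i} (factor (toℕ i) ∘ toℕ) * factor (toℕ i) (n ℕ.∸ toℕ i)) * factor n (n ℕ.∸ n)
      ≈⟨ *-congʳ (product-* {n} (λ i → product {n ℕ.∸ toℕ i} (factor (toℕ i) ∘ toℕ)) (λ i → factor (toℕ i) (n ℕ.∸ toℕ i))) ⟩
    pochhammers n * product {n} (λ i → factor (toℕ i) (n ℕ.∸ toℕ i)) * factor n (n ℕ.∸ n)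
      ≈⟨ *-assoc _ _ _ ⟩
    pochhammers n * (product {n} (λ i → factor (toℕ i) (n ℕ.∸ toℕ i)) * factor n (n ℕ.∸ n))
      ≈⟨ *-congˡ (trans (linProduct-progression n (suc n) ℕₚ.≤-refl) (product-last n λ i → factor i (n ℕ.∸ i))) ⟨
    pochhammers n * linProduct (progression n (suc n))
      ≈⟨ *-comm _ _ ⟩
    linProduct (progression n (suc n)) * pochhammers n ∎
    where
    step : ∀ i → i ≤ n → product {suc n ℕ.∸ i} (factor i ∘ toℕ) ≈ product {n ℕ.∸ i} (factor i ∘ toℕ) * factor i (n ℕ.∸ i)
    step i i≤n = trans (reflexive (≡.cong (λ d → product {d} (factor i ∘ toℕ)) (ℕₚ.+-∸-assoc 1 i≤n)))
      (product-last (n ℕ.∸ i) (factor i))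

  linProduct-allRoots : ∀ n → linProduct (allRoots (suc n)) ≈ (x + num 2) * (x + num 3) * pochhammers (suc n)
  linProduct-allRoots zero    = begin
    lin 2 * (lin 3 * linProduct (progression 0 1 ++ []))
      ≈⟨ *-congˡ (*-congˡ (linProduct-++ (progression 0 1) [])) ⟩
    lin 2 * (lin 3 * (linProduct (progression 0 1) * 1#))
      ≈⟨ *-assoc (lin 2) (lin 3) _ ⟨
    lin 2 * lin 3 * (linProduct (progression 0 1) * 1#)
      ≈⟨ *-congˡ (pochhammers-suc 0) ⟨
    lin 2 * lin 3 * pochhammers 1 ∎
  linProduct-allRoots (suc n) = begin
    linProduct (progression (suc n) (suc (suc n)) ++ allRoots (suc n))
      ≈⟨ trans (linProduct-++ (progression (suc n) (suc (suc n))) (allRoots (suc n))) (*-congˡ (linProduct-allRoots n)) ⟩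
    linProduct (progression (suc n) (suc (suc n))) * (lin 2 * lin 3 * pochhammers (suc n))
      ≈⟨ solve 3 (λ a b c → a :* (b :* c) := b :* (a :* c)) refl
           (linProduct (progression (suc n) (suc (suc n)))) (lin 2 * lin 3) (pochhammers (suc n)) ⟩
    lin 2 * lin 3 * (linProduct (progression (suc n) (suc (suc n))) * pochhammers (suc n))
      ≈⟨ *-congˡ (pochhammers-suc (suc n)) ⟨
    lin 2 * lin 3 * pochhammers (suc (suc n)) ∎

  det-scaled : ∀ n (a : ℕ → ℕ → Carrier) {b} → det {n} (λ i j → a (toℕ i) (toℕ j)) ≈ b →
    det {n} (λ i j → x ^ toℕ i * a (toℕ i) (toℕ j)) ≈ x ^ triangle n * b
  det-scaled n a h = trans
    (DeterminantProperties.det-scaleRows ring {n} (λ i → x ^ toℕ i) (λ i j → a (toℕ i) (toℕ j)))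
    (*-cong (product-^ n) h)

  -- The constant of the theorem is 2 γ, with γ the product of the `leadingFactor`s. Inserting γ⁻¹ γ
  -- = 1 moves γ to the constant and leaves γ⁻¹ with the cofactor.
  det-factorisation : ∀ n → 1 ≤ n → ∀ γ⁻¹ → γ⁻¹ ℚ.* Qₐ.product {n} (leadingFactor ∘ toℕ) ≡ 1ℚ →
    det {n} (λ i j → matrix (toℕ i) (toℕ j)) ≈
    num 2 * num 6 ^ (n C 2) * product {n} (λ i → ι (factorialRatio (toℕ i) (2 ℕ.* toℕ i ℕ.+ 3)))
      * ((x + num 2) * (x + num 3) * pochhammers n) * (ι γ⁻¹ * proj₁ (linProduct-∣-rowDet n))
  det-factorisation (suc n) _ γ⁻¹ γ-inverse = begin
    det {suc n} (λ i j → matrix (toℕ i) (toℕ j))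
      ≈⟨ trans (det-matrix n) (*-congˡ (trans (proj₂ (linProduct-∣-rowDet (suc n))) (*-congʳ (linProduct-allRoots n)))) ⟩
    num 2 * (l * q)
      ≈⟨ *-congˡ (*-congˡ (*-identityˡ q)) ⟨
    num 2 * (l * (1# * q))
      ≈⟨ *-congˡ (*-congˡ (*-congʳ (trans (sym (ι-* γ⁻¹ γ)) (trans (reflexive (≡.cong ι γ-inverse)) ι-1)))) ⟨
    num 2 * (l * (ι γ⁻¹ * ι γ * q))
      ≈⟨ solve 5 (λ a l i g q → a :* (l :* (i :* g :* q)) := a :* g :* l :* (i :* q)) refl (num 2) l (ι γ⁻¹) (ι γ) q ⟩
    num 2 * ι γ * l * (ι γ⁻¹ * q)
      ≈⟨ *-congʳ (*-congʳ (trans (*-congˡ (ι-leadingFactors (suc n))) (sym (*-assoc _ _ _)))) ⟩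
    num 2 * num 6 ^ (suc n C 2) * product {suc n} (λ i → ι (factorialRatio (toℕ i) (2 ℕ.* toℕ i ℕ.+ 3)))
      * l * (ι γ⁻¹ * q) ∎
    where
    γ : ℚ
    γ = Qₐ.product {suc n} (leadingFactor ∘ toℕ)

    l q : Carrier
    l = (x + num 2) * (x + num 3) * pochhammers (suc n)
    q = proj₁ (linProduct-∣-rowDet (suc n))

-- The monic cofactor in ℚ[x]

private
  module ℚ[x]-products = ProductForms polynomialAlgebra x x+nat-cancel
  open LeadingCoefficient using (leadingFactor; det-rowLeading; Invertible-product; Invertible-leadingFactor)
  open ℚ[x]-factors using (linProduct)
  module ℚ[x]-rows = Rows polynomialAlgebra x x+nat-cancel
  open ℚ[x]-rows using (row; rowDet; linProduct-∣-rowDet)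

leadingCoefficient : ℕ → ℚ
leadingCoefficient n = ℚ-Algebra.product ℚ-algebra {n} (leadingFactor ∘ toℕ)

-- The determinant of the scaled rows has a known degree bound and top coefficient. Removing the
-- powers of x and then the linear factors, all monic, lowers the bound and preserves the
-- coefficient.
Leading-cofactor : ∀ n → 1 ≤ n → ∀ q → rowDet n P.≈ linProduct (allRoots n) P.* q →
                   Leading (2 ℕ.* n ∸ 2) (leadingCoefficient n) q
Leading-cofactor n 1≤n q h = Leading-linProduct-cancel roots q
  (Leading-x^-cancel (triangle n) (linProduct roots P.* q)
  (Leading-cong {p = scaledDet} {Defs.x P.^ triangle n P.* (linProduct roots P.* q)}
    (ℚ[x]-products.det-scaled n row {linProduct roots P.* q} h)
  (Leading-≡ {p = scaledDet} (det-rowLeading n)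
  (≡.subst (λ d → Leading d topDet scaledDet) (degrees n 1≤n)
  (Leading-det {n} (column ∘ toℕ) (λ i j → rowLeading (toℕ i) (column (toℕ j)))
    (λ i j → x P.^ toℕ i P.* row (toℕ i) (toℕ j))
    λ i j → LeadingSeries-row (toℕ i) (column (toℕ j)))))))
  where
  roots : List ℕ
  roots = allRoots n

  scaledDet : Polynomial
  scaledDet = Determinant.det ℚ[x] {n} λ i j → x P.^ toℕ i P.* row (toℕ i) (toℕ j)

  topDet : ℚ
  topDet = Determinant.det ℚ-rawRing {n} λ i j → rowLeading (toℕ i) (column (toℕ j))

open Defs

theorem16 : ∀ (n : ℕ) → 1 ≤ n →
    ∃ λ (Pol : Polynomial) →
    MonicOfDegree (2 ℕ.* n ∸ 2) Pol
    × (det[ i , j < n ]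
    (nat 4 ^ i * binomial (x + nat i + nat (2 ℕ.* j) + nat 3) (+ (2 ℕ.* j ℕ.+ 3))
    + binomial (x - nat i + nat (2 ℕ.* j) + nat 3) (+ (2 ℕ.* j ℕ.+ 3))))
    ≈ (nat 2 * nat 6 ^ (n C 2) * (∏[ i < n ] const (factorialRatio i (2 ℕ.* i ℕ.+ 3))))
    * ((x + nat 2) * (x + nat 3)
    * (∏[ i < n ] pochhammer (x + nat (3 ℕ.* i) + nat 1) (n ∸ i)))
    * Pol
-- Over ℚ[x] the terms of the abstract factorisation unfold to the expressions of the statement.
theorem16 n 1≤n = const γ⁻¹ * q , monic , ℚ[x]-products.det-factorisation n 1≤n γ⁻¹ (proj₂ γ-invertible)
  where
  γ-invertible : LeadingCoefficient.Invertible (leadingCoefficient n)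
  γ-invertible = Invertible-product {n} (leadingFactor ∘ toℕ) (λ i → Invertible-leadingFactor (toℕ i))

  γ⁻¹ : ℚ
  γ⁻¹ = proj₁ γ-invertible

  q : Polynomial
  q = proj₁ (linProduct-∣-rowDet n)

  leading-Pol : Leading (2 ℕ.* n ∸ 2) 1ℚ (const γ⁻¹ * q)
  leading-Pol = Leading-≡ (proj₂ γ-invertible) (Leading-* {p = const γ⁻¹} {q} (Leading-const γ⁻¹)
    (Leading-cofactor n 1≤n q (proj₂ (linProduct-∣-rowDet n))))

  monic : MonicOfDegree (2 ℕ.* n ∸ 2) (const γ⁻¹ * q)
  monic = record { leading = top leading-Pol ; above = above leading-Pol }
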